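{- Let $h\geq 2$ and $r\geq 2$ be integers, and let $F_{1},F_{2},\dots,F_{h}$ be vertex-critical graphs with $\chi(F_{i})=r+1\geq 3$ for every $1\leq i\leq h$, such that $F_{1},F_{2},\dots,F_{h}$ is properly ordered. Then, for all sufficiently large $n$, $$\mathrm{ex}\Big(n,\bigcup_{1\leq i\leq h}F_{i}\Big)=\max_{1\leq \ell\leq h}\left\{\binom{\ell-1}{2}+(\ell-1)(n-\ell+1)+\mathrm{ex}(n-\ell+1,F_{\ell})\right\}.$$ Moreover, every graph in $\mathrm{EX}(n,\bigcup_{1\leq i\leq h}F_{i})$ is of the form $K_{\ell-1}\prod H$ for some $1\leq \ell\leq h$, where $H\in \mathrm{EX}(n-\ell+1,F_{\ell})$.
   Context: All graphs are finite, simple and undirected; $\chi(G)$ is the chromatic number. For a graph $F$, a graph $G$ is $F$-free if it contains no subgraph isomorphic to $F$; $\mathrm{EX}(n,F)$ is the set of $F$-free graphs on $n$ vertices with the maximum possible number of edges, and $\mathrm{ex}(n,F)$ is the number of edges of any graph in $\mathrm{EX}(n,F)$. A graph $F$ is vertex-critical if there is a vertex $u$ of $F$ with $\chi(F-u)=\chi(F)-1$. $\bigcup_{1\leq i\leq h}F_{i}$ denotes the vertex-disjoint union of $F_1,\dots,F_h$. For graphs $G_1,G_2$, $G_1\prod G_2$ denotes the join: the disjoint union of $G_1$ and $G_2$ together with all edges between $V(G_1)$ and $V(G_2)$; $K_{0}\prod H$ means $H$. $K_m$ is the complete graph on $m$ vertices, and $\binom{a}{2}=0$ for $a\in\{0,1\}$.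 Graphs $F_{1},\dots,F_{h}$, all with chromatic number $r+1\geq 3$, are called properly ordered if for every (sufficiently large) number of vertices $N$ and every $1\leq \ell\leq h$, there exists at least one graph in $\mathrm{EX}(N,F_{\ell})$ that contains no copy of any $F_{j}$ with $1\leq j\leq \ell$. -}

module Defs where

open import Data.Nat using (ℕ; zero; suc; _+_; _*_; _∸_; _≤_; _⊔_; _<ᵇ_)
open import Data.Nat.Combinatorics using (_C_)
open import Data.Fin using (Fin; zero; suc; toℕ; splitAt; punchIn; _≟_)
open import Data.Bool using (Bool; true; false; not; _∧_; if_then_else_)
open import Data.Sum using (_⊎_; inj₁; inj₂)
open import Data.Product using (Σ; ∃; _×_; _,_)
open import Data.Empty using (⊥)
open import Relation.Nullary using (¬_; yes; no)
open import Relation.Nullary.Decidable using (isYes)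
open import Relation.Binary.PropositionalEquality using (_≡_; _≢_; refl; sym)
open import Function.Definitions using (Injective; Bijective)

record Graph (n : ℕ) : Set where
  field
    adj    : Fin n → Fin n → Bool
    adjSym : ∀ i j → adj i j ≡ adj j i
    irrefl : ∀ i → adj i i ≡ false
open Graph public

Σᶠ : (n : ℕ) → (Fin n → ℕ) → ℕ
Σᶠ zero    f = 0
Σᶠ (suc n) f = f zero + Σᶠ n (λ i → f (suc i))

maxᶠ : (n : ℕ) → (Fin n → ℕ) → ℕ
maxᶠ zero    f = 0
maxᶠ (suc n) f = f zero ⊔ maxᶠ n (λ i → f (suc i))

edges : ∀ {n} → Graph n → ℕ
edges {n} G = Σᶠ n λ i → Σᶠ n λ j →
  if (toℕ i <ᵇ toℕ j) ∧ adj G i j then 1 else 0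

_⊆_ : ∀ {k n} → Graph k → Graph n → Set
_⊆_ {k} {n} F G = Σ (Fin k → Fin n) λ f →
  Injective _≡_ _≡_ f × (∀ i j → adj F i j ≡ true → adj G (f i) (f j) ≡ true)

Free : ∀ {k n} → Graph k → Graph n → Set
Free F G = ¬ (F ⊆ G)

IsEX : ∀ {k} (n : ℕ) → Graph k → Graph n → Set
IsEX n F G = Free F G × (∀ (G' : Graph n) → Free F G' → edges G' ≤ edges G)

_≅_ : ∀ {m n} → Graph m → Graph n → Set
_≅_ {m} {n} A B = Σ (Fin m → Fin n) λ f →
  Bijective _≡_ _≡_ f × (∀ x y → adj A x y ≡ adj B (f x) (f y))

ProperColouring : ∀ {n} → Graph n → (c : ℕ) → (Fin n → Fin c) → Set
ProperColouring G c col = ∀ i j → adj G i j ≡ true → col i ≢ col j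

Colourable : ∀ {n} → Graph n → ℕ → Set
Colourable {n} G c = Σ (Fin n → Fin c) (ProperColouring G c)

ChromaticNumber : ∀ {n} → Graph n → ℕ → Set
ChromaticNumber G c = Colourable G c × (∀ d → Colourable G d → c ≤ d)

deleteVertex : ∀ {m} → Graph (suc m) → Fin (suc m) → Graph m
deleteVertex G u = record
  { adj    = λ i j → adj G (punchIn u i) (punchIn u j)
  ; adjSym = λ i j → adjSym G (punchIn u i) (punchIn u j)
  ; irrefl = λ i → irrefl G (punchIn u i)
  }

VertexCritical : ∀ {n} → Graph n → Set
VertexCritical {zero}  F = ⊥
VertexCritical {suc m} F =
  Σ ℕ λ c → ChromaticNumber F c × Σ (Fin (suc m)) λ u →
    ChromaticNumber (deleteVertex F u) (c ∸ 1)

combine : ∀ {m k} → (Fin m → Fin m → Bool) → (Fin k → Fin k → Bool) → Bool →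
          Fin m ⊎ Fin k → Fin m ⊎ Fin k → Bool
combine a b c (inj₁ x) (inj₁ y) = a x y
combine a b c (inj₁ x) (inj₂ y) = c
combine a b c (inj₂ x) (inj₁ y) = c
combine a b c (inj₂ x) (inj₂ y) = b x y

combine-sym : ∀ {m k} (a : Fin m → Fin m → Bool) (b : Fin k → Fin k → Bool) c →
  (∀ x y → a x y ≡ a y x) → (∀ x y → b x y ≡ b y x) →
  ∀ s t → combine a b c s t ≡ combine a b c t s
combine-sym a b c sa sb (inj₁ x) (inj₁ y) = sa x y
combine-sym a b c sa sb (inj₁ x) (inj₂ y) = refl
combine-sym a b c sa sb (inj₂ x) (inj₁ y) = refl
combine-sym a b c sa sb (inj₂ x) (inj₂ y) = sb x y

combine-irr : ∀ {m k} (a : Fin m → Fin m → Bool) (b : Fin k → Fin k → Bool) c →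
  (∀ x → a x x ≡ false) → (∀ x → b x x ≡ false) →
  ∀ s → combine a b c s s ≡ false
combine-irr a b c ia ib (inj₁ x) = ia x
combine-irr a b c ia ib (inj₂ x) = ib x

sumGraph : ∀ {m k} → Bool → Graph m → Graph k → Graph (m + k)
sumGraph {m} c A B = record
  { adj    = λ x y → combine (adj A) (adj B) c (splitAt m x) (splitAt m y)
  ; adjSym = λ x y → combine-sym (adj A) (adj B) c (adjSym A) (adjSym B)
                       (splitAt m x) (splitAt m y)
  ; irrefl = λ x → combine-irr (adj A) (adj B) c (irrefl A) (irrefl B) (splitAt m x)
  }

_⊎ᴳ_ : ∀ {m k} → Graph m → Graph k → Graph (m + k)
A ⊎ᴳ B = sumGraph false A B

_∏_ : ∀ {m k} → Graph m → Graph k → Graph (m + k)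
A ∏ B = sumGraph true A B

emptyGraph : Graph 0
emptyGraph = record { adj = λ () ; adjSym = λ () ; irrefl = λ () }

K : (m : ℕ) → Graph m
K m = record
  { adj    = λ x y → not (isYes (x ≟ y))
  ; adjSym = symK
  ; irrefl = irrK
  }
  where
  symK : ∀ (x y : Fin m) → not (isYes (x ≟ y)) ≡ not (isYes (y ≟ x))
  symK x y with x ≟ y | y ≟ x
  ... | yes _ | yes _ = refl
  ... | no _  | no _  = refl
  ... | yes p | no ¬q with ¬q (sym p)
  ... | ()
  symK x y | no ¬p | yes q with ¬p (sym q)
  ... | ()
  irrK : ∀ (x : Fin m) → not (isYes (x ≟ x)) ≡ false
  irrK x with x ≟ x
  ... | yes _ = refl
  ... | no ¬p with ¬p refl
  ... | ()

totalV : (h : ℕ) → (Fin h → ℕ) → ℕ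
totalV zero    v = 0
totalV (suc h) v = v zero + totalV h (λ i → v (suc i))

⋃ : (h : ℕ) (v : Fin h → ℕ) → ((i : Fin h) → Graph (v i)) → Graph (totalV h v)
⋃ zero    v F = emptyGraph
⋃ (suc h) v F = F zero ⊎ᴳ ⋃ h (λ i → v (suc i)) (λ i → F (suc i))

-- Properly ordered (index i : Fin h stands for ℓ = toℕ i + 1)

ProperlyOrdered : (h : ℕ) (v : Fin h → ℕ) → ((i : Fin h) → Graph (v i)) → Set
ProperlyOrdered h v F =
  ∃ λ N₀ → ∀ N → N₀ ≤ N → ∀ (ℓ : Fin h) →
    Σ (Graph N) λ G → IsEX N (F ℓ) G × (∀ (j : Fin h) → toℕ j ≤ toℕ ℓ → Free (F j) G)

{-# OPTIONS --safe #-}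

-- Let W be the set of vertices of an extremal G missing noticeably fewer than n/r vertices, and
-- s = |W|.  Since G is at least as dense as the Turán graph, the neighbourhood of a vertex of W is
-- dense enough for the Erdős–Stone theorem to give a large complete r-partite subgraph in it; as
-- F j minus its critical vertex is r-colourable, every vertex of W carries a copy of any F j that
-- avoids a prescribed bounded set.  Hence s < h.
--
-- If G − W contained F s, then, because F 0, …, F (s − 1) can be placed through W, for some j > s
-- the graph G − W minus a bounded set would be F j-free.  But then K j ∏ H with H extremal for F j
-- has more edges than G: each additional universal vertex gains about n/r, while every other vertex
-- has at most about (1 − 1/r)n neighbours, and ex(m + 1, F j) − ex(m, F j) is at least about
-- (1 − 1/r)m.  The last bound comes from cloning: in an extremal graph some |F j| vertices of one
-- part of a complete r-partite subgraph have almost (1 − 1/r)m common neighbours, and a new vertex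
-- joined to these creates no F j.
--
-- So G − W is F s-free, e(G) ≤ e(K s ∏ (G − W)) ≤ e(K s ∏ H) for H extremal for F s, and proper
-- ordering makes some such K s ∏ H free of the union, which forces equality throughout.
module Submission where

open import Defs hiding (combine)
open import Data.Nat using (ℕ; zero; suc; _+_; _*_; _∸_; _^_; _≤_; _<_; z≤n; s≤s; _≤?_; _<?_; _<ᵇ_; NonZero; >-nonZero)
open import Data.Nat.Properties hiding (_≟_; suc-injective)
open import Data.Nat.DivMod using (_/_; _%_; _mod_; m≡m%n+[m/n]*n; m/n*n≤m; /-monoˡ-≤; m%n<n)
open import Data.Nat.Combinatorics using (_C_; nCk+nC[k+1]≡[n+1]C[k+1]; nC1≡n)
open import Data.Nat.Tactic.RingSolver using (solve-∀)
open import Data.Fin using (Fin; zero; suc; toℕ; _≟_; inject≤; combine; remQuot; punchOut; _↑ˡ_; _↑ʳ_; splitAt; join; fromℕ<)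
open import Data.Fin.Properties using (any?; all?; ¬∀⟶∃¬; suc-injective; inject≤-injective; remQuot-combine; combine-injective; punchIn-punchOut; toℕ-injective; toℕ<n; toℕ-fromℕ<; fromℕ<-injective; splitAt-↑ˡ; splitAt-↑ʳ; splitAt⁻¹-↑ˡ; splitAt⁻¹-↑ʳ; join-splitAt; ↑ˡ-injective; ↑ʳ-injective; injective⇒≤)
open import Data.Bool using (Bool; true; false; not; _∧_; _∨_; if_then_else_)
open import Data.Bool.Properties using (not-involutive) renaming (_≟_ to _≟ᵇ_)
open import Data.Sum using (_⊎_; inj₁; inj₂)
open import Data.Product using (Σ; ∃; _×_; _,_; proj₁; proj₂)
open import Data.Empty using (⊥; ⊥-elim)
open import Function using (_∘_; mk⇔)
open import Function.Definitions using (Injective)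
open import Relation.Nullary using (¬_; Dec; yes; no; does)
open import Relation.Nullary.Decidable using (dec-true; dec-false; does-⇔; isYes; _×-dec_)
open import Relation.Binary.Definitions using (tri<; tri≈; tri>)
open import Relation.Binary.PropositionalEquality using (_≡_; _≢_; refl; sym; trans; cong; cong₂; subst; subst₂; module ≡-Reasoning)

-- Densities are cross-multiplied inequalities in ℕ: `suc q * (r * d) ≤ q * n` says that d is at
-- most (1 - 1/(q + 1))n/r. Non-adjacent pairs are counted ordered and with the diagonal, so that
-- the Turán graph has n²/r of them up to a linear term.
--
-- Nothing bounds |W| at first, whereas the neighbourhood of v is only known to be dense if few
-- vertices have fewer non-neighbours than v. Hence copies are placed through vertices below a
-- cut-off that at most h vertices undercut.
--
-- The obstacle in cloning is that |F j| vertices, each missing about m/r others, might together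
-- miss |F j| times as many. They do not: every vertex of an F j-free graph misses nearly all of
-- some part, which already uses up almost all non-adjacencies between the parts and the graph. So
-- the sets missed by the vertices of an average block nearly coincide.
--
-- Since `Free` is a negation, its failure yields no witness; copies obtained from such a failure
-- stay under a double negation until a contradiction is reached.

-- A polynomial inequality x ≤ y follows from a ≤ b once x + b + c ≡ y + a is a semiring identity.
≤-from : ∀ {a b} x y c → a ≤ b → x + b + c ≡ y + a → x ≤ y
≤-from {a} {b} x y c a≤b eq = +-cancelʳ-≤ b x y (begin
  x + b       ≤⟨ m≤m+n (x + b) c ⟩
  x + b + c   ≡⟨ eq ⟩
  y + a       ≤⟨ +-monoʳ-≤ y a≤b ⟩
  y + b       ∎)
  where open ≤-Reasoning

Injective′ : ∀ {m n} → (Fin m → Fin n) → Set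
Injective′ f = Injective _≡_ _≡_ f

-- Truth values as 0 and 1

⟦_⟧ : Bool → ℕ
⟦ true  ⟧ = 1
⟦ false ⟧ = 0

⟦⟧≤1 : ∀ b → ⟦ b ⟧ ≤ 1
⟦⟧≤1 true  = ≤-refl
⟦⟧≤1 false = z≤n

⟦not⟧ : ∀ b → ⟦ b ⟧ + ⟦ not b ⟧ ≡ 1
⟦not⟧ true  = refl
⟦not⟧ false = refl

⟦⟧-≤ : ∀ {b c} → (b ≡ true → c ≡ true) → ⟦ b ⟧ ≤ ⟦ c ⟧
⟦⟧-≤ {false}        _ = z≤n
⟦⟧-≤ {true} {true}  _ = ≤-refl
⟦⟧-≤ {true} {false} f with f refl
... | ()

⟦∨⟧ : ∀ b c → ⟦ b ∨ c ⟧ ≤ ⟦ b ⟧ + ⟦ c ⟧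
⟦∨⟧ true  c = m≤m+n 1 ⟦ c ⟧
⟦∨⟧ false c = ≤-refl

⟦⟧*-≤ : ∀ b {x y} → (b ≡ true → x ≤ y) → ⟦ b ⟧ * x ≤ y
⟦⟧*-≤ true  le = ≤-trans (≤-reflexive (*-identityˡ _)) (le refl)
⟦⟧*-≤ false le = z≤n

⟦⟧*-true : ∀ b {x} → b ≡ true → ⟦ b ⟧ * x ≡ x
⟦⟧*-true _ refl = *-identityˡ _

∨-false : ∀ {b c} → b ∨ c ≡ false → b ≡ false × c ≡ false
∨-false {false} eq = refl , eq

true≢false : ∀ {b} → b ≡ true → b ≡ false → ⊥
true≢false refl ()

not-true : ∀ {b} → not b ≡ true → b ≡ false
not-true {false} _ = refl

∧-true : ∀ {b c} → b ∧ c ≡ true → b ≡ true × c ≡ true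
∧-true {true} eq = refl , eq

bool? : ∀ b → b ≡ true ⊎ b ≡ false
bool? true  = inj₁ refl
bool? false = inj₂ refl

does-true : ∀ {a} {A : Set a} (d : Dec A) → does d ≡ true → A
does-true (yes x) _ = x

does-false : ∀ {a} {A : Set a} (d : Dec A) → does d ≡ false → ¬ A
does-false (no x) _ = x

-- Finite sums

Σ-cong : ∀ n {f g : Fin n → ℕ} → (∀ i → f i ≡ g i) → Σᶠ n f ≡ Σᶠ n g
Σ-cong zero    eq = refl
Σ-cong (suc n) eq = cong₂ _+_ (eq zero) (Σ-cong n (eq ∘ suc))

Σ-mono : ∀ n {f g : Fin n → ℕ} → (∀ i → f i ≤ g i) → Σᶠ n f ≤ Σᶠ n g
Σ-mono zero    le = z≤n
Σ-mono (suc n) le = +-mono-≤ (le zero) (Σ-mono n (le ∘ suc))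

Σ-+ : ∀ n (f g : Fin n → ℕ) → Σᶠ n (λ i → f i + g i) ≡ Σᶠ n f + Σᶠ n g
Σ-+ zero    f g = refl
Σ-+ (suc n) f g = trans (cong (f zero + g zero +_) (Σ-+ n (f ∘ suc) (g ∘ suc)))
  (rearrange (f zero) (g zero) (Σᶠ n (f ∘ suc)) (Σᶠ n (g ∘ suc)))
  where
  rearrange : ∀ a b c d → a + b + (c + d) ≡ a + c + (b + d)
  rearrange = solve-∀

Σ-*ˡ : ∀ n c (f : Fin n → ℕ) → Σᶠ n (λ i → c * f i) ≡ c * Σᶠ n f
Σ-*ˡ zero    c f = sym (*-zeroʳ c)
Σ-*ˡ (suc n) c f = trans (cong (c * f zero +_) (Σ-*ˡ n c (f ∘ suc)))
  (sym (*-distribˡ-+ c (f zero) (Σᶠ n (f ∘ suc))))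

Σ-*ʳ : ∀ n c (f : Fin n → ℕ) → Σᶠ n (λ i → f i * c) ≡ Σᶠ n f * c
Σ-*ʳ n c f = trans (Σ-cong n (λ i → *-comm (f i) c)) (trans (Σ-*ˡ n c f) (*-comm c _))

Σ-const : ∀ n c → Σᶠ n (λ _ → c) ≡ n * c
Σ-const zero    c = refl
Σ-const (suc n) c = cong (c +_) (Σ-const n c)

Σ-zero : ∀ n → Σᶠ n (λ _ → 0) ≡ 0
Σ-zero n = trans (Σ-const n 0) (*-zeroʳ n)

Σ-swap : ∀ m n (f : Fin m → Fin n → ℕ) →
  Σᶠ m (λ i → Σᶠ n (f i)) ≡ Σᶠ n (λ j → Σᶠ m (λ i → f i j))
Σ-swap zero    n f = sym (Σ-zero n)
Σ-swap (suc m) n f = trans (cong (Σᶠ n (f zero) +_) (Σ-swap m n (f ∘ suc)))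
  (sym (Σ-+ n (f zero) (λ j → Σᶠ m (λ i → f (suc i) j))))

Σ-member : ∀ n (f : Fin n → ℕ) i → f i ≤ Σᶠ n f
Σ-member (suc n) f zero    = m≤m+n (f zero) _
Σ-member (suc n) f (suc i) = ≤-trans (Σ-member n (f ∘ suc) i) (m≤n+m _ (f zero))

-- For a termwise comparison that is better at one index: it serves for an edge present in only one
-- of two graphs and for the part that a vertex nearly misses.
Σ-mono-extra : ∀ n {f g : Fin n → ℕ} {a b} i → (∀ j → f j ≤ g j) → f i + a ≤ g i + b →
  Σᶠ n f + a ≤ Σᶠ n g + b
Σ-mono-extra (suc n) {f} {g} {a} {b} zero le ext =
  subst₂ _≤_ (swap (f zero) _ a) (swap (g zero) _ b) (+-mono-≤ ext (Σ-mono n (le ∘ suc)))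
  where
  swap : ∀ x y z → x + z + y ≡ x + y + z
  swap = solve-∀
Σ-mono-extra (suc n) {f} {g} {a} {b} (suc i) le ext =
  subst₂ _≤_ (sym (+-assoc (f zero) _ a)) (sym (+-assoc (g zero) _ b))
    (+-mono-≤ (le zero) (Σ-mono-extra n i (le ∘ suc) ext))

Σ-average : ∀ n (f : Fin (suc n) → ℕ) → ∃ λ i → suc n * f i ≤ Σᶠ (suc n) f
Σ-average zero    f = zero , ≤-refl
Σ-average (suc n) f with Σ-average n (f ∘ suc)
... | i , le with f zero ≤? f (suc i)
... | yes p = zero , +-monoʳ-≤ (f zero) (≤-trans (*-monoʳ-≤ (suc n) p) le)
... | no ¬p = suc i , +-mono-≤ (<⇒≤ (≰⇒> ¬p)) le

δ : ∀ {n} → Fin n → Fin n → ℕ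
δ i j = ⟦ does (i ≟ j) ⟧

δ-refl : ∀ {n} (i : Fin n) → δ i i ≡ 1
δ-refl i = cong ⟦_⟧ (dec-true (i ≟ i) refl)

δ-≢ : ∀ {n} {i j : Fin n} → i ≢ j → δ i j ≡ 0
δ-≢ {i = i} {j} ne = cong ⟦_⟧ (dec-false (i ≟ j) ne)

Σ-δ : ∀ {n} (i : Fin n) (f : Fin n → ℕ) → Σᶠ n (λ j → δ i j * f j) ≡ f i
Σ-δ {suc n} zero f = trans (cong (f zero + 0 +_) (Σ-zero n))
  (trans (+-identityʳ _) (+-identityʳ _))
Σ-δ {suc n} (suc i) f = Σ-δ i (f ∘ suc)

-- Cardinality of a decidable subset

count : ∀ {n} → (Fin n → Bool) → ℕ
count {n} S = Σᶠ n (λ i → ⟦ S i ⟧)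

count-mono : ∀ {n} {S T : Fin n → Bool} → (∀ i → S i ≡ true → T i ≡ true) → count S ≤ count T
count-mono {n} sub = Σ-mono n (λ i → ⟦⟧-≤ (sub i))

count-not : ∀ {n} (S : Fin n → Bool) → count S + count (not ∘ S) ≡ n
count-not {n} S = trans (sym (Σ-+ n _ _))
  (trans (Σ-cong n (λ i → ⟦not⟧ (S i))) (trans (Σ-const n 1) (*-identityʳ n)))

count-∨ : ∀ {n} (S T : Fin n → Bool) → count (λ i → S i ∨ T i) ≤ count S + count T
count-∨ {n} S T = ≤-trans (Σ-mono n (λ i → ⟦∨⟧ (S i) (T i))) (≤-reflexive (Σ-+ n _ _))

count≤n : ∀ {n} (S : Fin n → Bool) → count S ≤ n
count≤n S = ≤-trans (m≤m+n (count S) _) (≤-reflexive (count-not S))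

-- The domain `⟦ b ⟧ + m` is one unfolding of `count`, so that abstracting the Boolean in proofs
-- about `enum` refines the index type and the function together.
enumStep : ∀ {m n} b → (Fin m → Fin n) → Fin (⟦ b ⟧ + m) → Fin (suc n)
enumStep true  e zero    = zero
enumStep true  e (suc a) = suc (e a)
enumStep false e a       = suc (e a)

enum : ∀ {n} (S : Fin n → Bool) → Fin (count S) → Fin n
enum {suc n} S = enumStep (S zero) (enum (S ∘ suc))

enum-∈ : ∀ {n} (S : Fin n → Bool) a → S (enum S a) ≡ true
enum-∈ {suc n} S a with S zero in eq
enum-∈ {suc n} S zero    | true  = eq
enum-∈ {suc n} S (suc a) | true  = enum-∈ (S ∘ suc) a
enum-∈ {suc n} S a       | false = enum-∈ (S ∘ suc) a

enum-injective : ∀ {n} (S : Fin n → Bool) → Injective′ (enum S)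
enum-injective {suc n} S {a} {b} eq with S zero
enum-injective {suc n} S {zero}  {zero}  eq | true  = refl
enum-injective {suc n} S {suc a} {suc b} eq | true  =
  cong suc (enum-injective (S ∘ suc) (suc-injective eq))
enum-injective {suc n} S {a} {b} eq | false = enum-injective (S ∘ suc) (suc-injective eq)

choose : ∀ {n k} (S : Fin n → Bool) → k ≤ count S →
  Σ (Fin k → Fin n) λ f → Injective′ f × (∀ a → S (f a) ≡ true)
choose S k≤ = (λ a → enum S (inject≤ a k≤)) ,
  (λ {a} {b} eq → inject≤-injective k≤ k≤ a b (enum-injective S eq)) ,
  (λ a → enum-∈ S (inject≤ a k≤))

img : ∀ {m n} → (Fin m → Fin n) → Fin n → Bool
img f i = does (any? (λ a → f a ≟ i))

img-∈ : ∀ {m n} (f : Fin m → Fin n) a → img f (f a) ≡ true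
img-∈ f a = dec-true (any? (λ b → f b ≟ f a)) (a , refl)

img-∉ : ∀ {m n} (f : Fin m → Fin n) i → img f i ≡ false → ∀ a → f a ≢ i
img-∉ f i eq a p = does-false (any? (λ b → f b ≟ i)) eq (a , p)

img-preimage : ∀ {m n} (f : Fin m → Fin n) i → img f i ≡ true → ∃ λ a → f a ≡ i
img-preimage f i = does-true (any? (λ b → f b ≟ i))

-- Injectivity leaves at most one preimage, so the indicator of the image is a sum of point masses
-- and sums over the image can be interchanged with sums over the domain.
img-δ : ∀ {m n} (f : Fin m → Fin n) → Injective′ f → ∀ i →
  ⟦ img f i ⟧ ≡ Σᶠ m (λ a → δ (f a) i)
img-δ {m} f inj i with any? (λ a → f a ≟ i)
... | yes (a , refl) = sym (trans (Σ-cong m same) (Σ-δ a (λ _ → 1)))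
  where
  same : ∀ b → δ (f b) (f a) ≡ δ a b * 1
  same b with a ≟ b
  ... | yes refl = δ-refl (f a)
  ... | no a≢b   = δ-≢ (λ eq → a≢b (sym (inj eq)))
... | no none = sym (trans (Σ-cong m (λ b → δ-≢ (λ eq → none (b , eq)))) (Σ-zero m))

Σ-img : ∀ {m n} (f : Fin m → Fin n) → Injective′ f → (g : Fin n → ℕ) →
  Σᶠ n (λ i → ⟦ img f i ⟧ * g i) ≡ Σᶠ m (g ∘ f)
Σ-img {m} {n} f inj g = begin
  Σᶠ n (λ i → ⟦ img f i ⟧ * g i)              ≡⟨ Σ-cong n (λ i → cong (_* g i) (img-δ f inj i)) ⟩
  Σᶠ n (λ i → Σᶠ m (λ a → δ (f a) i) * g i)   ≡⟨ Σ-cong n (λ i → sym (Σ-*ʳ m (g i) _)) ⟩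
  Σᶠ n (λ i → Σᶠ m (λ a → δ (f a) i * g i))   ≡⟨ Σ-swap n m _ ⟩
  Σᶠ m (λ a → Σᶠ n (λ i → δ (f a) i * g i))   ≡⟨ Σ-cong m (λ a → Σ-δ (f a) g) ⟩
  Σᶠ m (g ∘ f)                                ∎
  where open ≡-Reasoning

Σ-injective : ∀ {m n} (f : Fin m → Fin n) → Injective′ f → (g : Fin n → ℕ) →
  Σᶠ m (g ∘ f) ≤ Σᶠ n g
Σ-injective {m} {n} f inj g = begin
  Σᶠ m (g ∘ f)                      ≡⟨ sym (Σ-img f inj g) ⟩
  Σᶠ n (λ i → ⟦ img f i ⟧ * g i)    ≤⟨ Σ-mono n (λ i → *-monoˡ-≤ (g i) (⟦⟧≤1 (img f i))) ⟩
  Σᶠ n (λ i → 1 * g i)              ≡⟨ Σ-cong n (λ i → *-identityˡ (g i)) ⟩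
  Σᶠ n g                            ∎
  where open ≤-Reasoning

count-img : ∀ {m n} (f : Fin m → Fin n) → Injective′ f → count (img f) ≡ m
count-img {m} {n} f inj = begin
  count (img f)                     ≡⟨ Σ-cong n (λ i → sym (*-identityʳ ⟦ img f i ⟧)) ⟩
  Σᶠ n (λ i → ⟦ img f i ⟧ * 1)      ≡⟨ Σ-img f inj (λ _ → 1) ⟩
  Σᶠ m (λ _ → 1)                    ≡⟨ trans (Σ-const m 1) (*-identityʳ m) ⟩
  m                                 ∎
  where open ≡-Reasoning

count-injective : ∀ {m n} (f : Fin m → Fin n) → Injective′ f → (S : Fin n → Bool) →
  (∀ a → S (f a) ≡ true) → m ≤ count S
count-injective f inj S f∈S = ≤-trans (≤-reflexive (sym (count-img f inj)))
  (count-mono λ i i∈ → let a , eq = img-preimage f i i∈ in subst (λ x → S x ≡ true) eq (f∈S a))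

count-split : ∀ {n} (S T : Fin n → Bool) →
  count S ≡ count (λ i → S i ∧ T i) + count (λ i → S i ∧ not (T i))
count-split {n} S T = trans (Σ-cong n (λ i → split (S i) (T i))) (Σ-+ n _ _)
  where
  split : ∀ b c → ⟦ b ⟧ ≡ ⟦ b ∧ c ⟧ + ⟦ b ∧ not c ⟧
  split false c     = refl
  split true  true  = refl
  split true  false = refl

-- Each test splits the current set in two, and one side keeps at least half of the guaranteed size;
-- hence a factor 2 per test.
homogeneous : ∀ {n} m (test : Fin m → Fin n → Bool) t (A : Fin n → Bool) → 2 ^ m * t ≤ count A →
  Σ (Fin n → Bool) λ A′ → (∀ x → A′ x ≡ true → A x ≡ true) × t ≤ count A′ ×
    (∀ i x y → A′ x ≡ true → A′ y ≡ true → test i x ≡ test i y)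
homogeneous zero test t A le =
  A , (λ _ p → p) , ≤-trans (≤-reflexive (sym (*-identityˡ t))) le , λ ()
homogeneous {n} (suc m) test t A le with 2 ^ m * t ≤? count (λ x → A x ∧ test zero x)
... | yes big =
  let A′ , sub , size , same = homogeneous m (test ∘ suc) t _ big in
  A′ , (λ x p → proj₁ (∧-true (sub x p))) , size ,
  λ { zero x y p p′ → trans (proj₂ (∧-true (sub x p))) (sym (proj₂ (∧-true (sub y p′))))
    ; (suc i) → same i }
... | no small =
  let A′ , sub , size , same = homogeneous m (test ∘ suc) t _ other in
  A′ , (λ x p → proj₁ (∧-true (sub x p))) , size ,
  λ { zero x y p p′ → trans (off x (sub x p)) (sym (off y (sub y p′)))
    ; (suc i) → same i }
  where
  off : ∀ x → A x ∧ not (test zero x) ≡ true → test zero x ≡ false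
  off x p = not-true (proj₂ (∧-true {A x} p))
  double : ∀ a b → (2 * a) * b ≡ a * b + a * b
  double = solve-∀
  other : 2 ^ m * t ≤ count (λ x → A x ∧ not (test zero x))
  other = +-cancelˡ-≤ (2 ^ m * t) _ _ (begin
    2 ^ m * t + 2 ^ m * t   ≡⟨ sym (double (2 ^ m) t) ⟩
    2 ^ suc m * t           ≤⟨ le ⟩
    count A                 ≡⟨ count-split A (test zero) ⟩
    count (λ x → A x ∧ test zero x) + count (λ x → A x ∧ not (test zero x))
                            ≤⟨ +-monoˡ-≤ _ (<⇒≤ (≰⇒> small)) ⟩
    2 ^ m * t + count (λ x → A x ∧ not (test zero x)) ∎)
    where open ≤-Reasoning

-- Bilinear forms

form : ∀ {n} → (Fin n → Fin n → ℕ) → (Fin n → ℕ) → (Fin n → ℕ) → ℕ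
form {n} M f g = Σᶠ n (λ i → f i * Σᶠ n (λ j → g j * M i j))

form-congˡ : ∀ {n} (M : Fin n → Fin n → ℕ) {f f′ : Fin n → ℕ} g →
  (∀ i → f i ≡ f′ i) → form M f g ≡ form M f′ g
form-congˡ {n} M g eq = Σ-cong n (λ i → cong (_* Σᶠ n (λ j → g j * M i j)) (eq i))

form-sym : ∀ {n} (M : Fin n → Fin n → ℕ) → (∀ i j → M i j ≡ M j i) → ∀ f g →
  form M f g ≡ form M g f
form-sym {n} M M-sym f g = begin
  Σᶠ n (λ i → f i * Σᶠ n (λ j → g j * M i j))     ≡⟨ Σ-cong n (λ i → sym (Σ-*ˡ n (f i) _)) ⟩
  Σᶠ n (λ i → Σᶠ n (λ j → f i * (g j * M i j)))   ≡⟨ Σ-swap n n _ ⟩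
  Σᶠ n (λ j → Σᶠ n (λ i → f i * (g j * M i j)))   ≡⟨ Σ-cong n (λ j → Σ-cong n (λ i →
    trans (cong (λ x → f i * (g j * x)) (M-sym i j)) (swap (f i) (g j) (M j i)))) ⟩
  Σᶠ n (λ j → Σᶠ n (λ i → g j * (f i * M j i)))   ≡⟨ Σ-cong n (λ j → Σ-*ˡ n (g j) _) ⟩
  Σᶠ n (λ j → g j * Σᶠ n (λ i → f i * M j i))     ∎
  where
  open ≡-Reasoning
  swap : ∀ x y z → x * (y * z) ≡ y * (x * z)
  swap = solve-∀

form-+ˡ : ∀ {n} (M : Fin n → Fin n → ℕ) f f′ g →
  form M (λ i → f i + f′ i) g ≡ form M f g + form M f′ g
form-+ˡ {n} M f f′ g =
  trans (Σ-cong n (λ i → *-distribʳ-+ (Σᶠ n (λ j → g j * M i j)) (f i) (f′ i))) (Σ-+ n _ _)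

-- The expansion of `form M g g` for g = f - k without subtraction. The mixed term keeps `f` instead
-- of `g`: when `k` marks discarded vertices, it sums their full degrees.
form-split : ∀ {n} (M : Fin n → Fin n → ℕ) → (∀ i j → M i j ≡ M j i) → ∀ f g k →
  (∀ i → f i ≡ g i + k i) → form M f f + form M k k ≡ form M g g + 2 * form M k f
form-split M M-sym f g k f≡ = begin
  form M f f + form M k k
    ≡⟨ cong (_+ form M k k) (trans (split f) (cong₂ _+_ (split′ g) (split′ k))) ⟩
  form M g g + form M g k + (form M k g + form M k k) + form M k k
    ≡⟨ cong (λ x → form M g g + x + (form M k g + form M k k) + form M k k) (form-sym M M-sym g k) ⟩
  form M g g + form M k g + (form M k g + form M k k) + form M k k
    ≡⟨ rearrange (form M g g) (form M k g) (form M k k) ⟩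
  form M g g + 2 * (form M k g + form M k k)
    ≡⟨ cong (λ x → form M g g + 2 * x) (sym (split′ k)) ⟩
  form M g g + 2 * form M k f ∎
  where
  open ≡-Reasoning
  split : ∀ x → form M f x ≡ form M g x + form M k x
  split x = trans (form-congˡ M x f≡) (form-+ˡ M g k x)
  split′ : ∀ x → form M x f ≡ form M x g + form M x k
  split′ x = trans (form-sym M M-sym x f)
    (trans (split x) (cong₂ _+_ (form-sym M M-sym g x) (form-sym M M-sym k x)))
  rearrange : ∀ a b c → a + b + (b + c) + c ≡ a + 2 * (b + c)
  rearrange = solve-∀

-- Non-adjacency counts; a vertex is a non-neighbour of itself, so the diagonal is included.

na : ∀ {n} → Graph n → Fin n → Fin n → ℕ
na G i j = ⟦ not (adj G i j) ⟧

na-sym : ∀ {n} (G : Graph n) i j → na G i j ≡ na G j i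
na-sym G i j = cong (⟦_⟧ ∘ not) (adjSym G i j)

nonDeg : ∀ {n} → Graph n → (Fin n → Bool) → Fin n → ℕ
nonDeg {n} G S v = Σᶠ n (λ j → ⟦ S j ⟧ * na G v j)

nonEdges : ∀ {n} → Graph n → (Fin n → Bool) → ℕ
nonEdges G S = form (na G) (⟦_⟧ ∘ S) (⟦_⟧ ∘ S)

remove : ∀ {n} → (Fin n → Bool) → Fin n → Fin n → Bool
remove S v i = S i ∧ not (does (v ≟ i))

remove-split : ∀ {n} (S : Fin n → Bool) v → S v ≡ true → ∀ i → ⟦ S i ⟧ ≡ ⟦ remove S v i ⟧ + δ v i
remove-split S v v∈S i with v ≟ i
... | yes refl rewrite v∈S = refl
... | no _ with S i
... | true  = refl
... | false = refl

count-remove : ∀ {n} (S : Fin n → Bool) v → S v ≡ true → count S ≡ suc (count (remove S v))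
count-remove {n} S v v∈S = begin
  count S                                         ≡⟨ Σ-cong n (remove-split S v v∈S) ⟩
  Σᶠ n (λ i → ⟦ remove S v i ⟧ + δ v i)           ≡⟨ Σ-+ n _ _ ⟩
  count (remove S v) + Σᶠ n (δ v)                 ≡⟨ cong (count (remove S v) +_)
    (trans (Σ-cong n (λ i → sym (*-identityʳ (δ v i)))) (Σ-δ v (λ _ → 1))) ⟩
  count (remove S v) + 1                          ≡⟨ +-comm _ 1 ⟩
  suc (count (remove S v))                        ∎
  where open ≡-Reasoning

-- The 1 corrects for the diagonal pair at `v`, which lies both in its row and in its column.
nonEdges-remove : ∀ {n} (G : Graph n) S v → S v ≡ true →
  nonEdges G S + 1 ≡ nonEdges G (remove S v) + 2 * nonDeg G S v
nonEdges-remove {n} G S v v∈S = begin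
  nonEdges G S + 1
    ≡⟨ cong (nonEdges G S +_) (sym diag) ⟩
  nonEdges G S + form (na G) (δ v) (δ v)
    ≡⟨ form-split (na G) (na-sym G) _ (⟦_⟧ ∘ remove S v) (δ v) (remove-split S v v∈S) ⟩
  nonEdges G (remove S v) + 2 * form (na G) (δ v) (⟦_⟧ ∘ S)
    ≡⟨ cong (λ x → nonEdges G (remove S v) + 2 * x) (Σ-δ v _) ⟩
  nonEdges G (remove S v) + 2 * nonDeg G S v ∎
  where
  open ≡-Reasoning
  diag : form (na G) (δ v) (δ v) ≡ 1
  diag = trans (Σ-δ v _) (trans (Σ-δ v _) (cong (⟦_⟧ ∘ not) (irrefl G v)))

-- Erdős–Stone

-- Different parts are disjoint by `cross`, because no vertex is adjacent to itself. Edges inside a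
-- part are allowed, since only containment as a subgraph matters.
record Multipartite {n} (G : Graph n) (S : Fin n → Bool) (r t : ℕ) : Set where
  field
    part   : Fin r → Fin t → Fin n
    inside : ∀ i a → S (part i a) ≡ true
    part-injective : ∀ i → Injective′ (part i)
    cross  : ∀ {i j} → i ≢ j → ∀ a b → adj G (part i a) (part j b) ≡ true
open Multipartite public

-- For `P` > 0 this is a minimum degree of (1 - 1/P + ε)|S| inside `S`, where ε = 1/(P(q + 1)).
Dense : ∀ {n} → ℕ → ℕ → Graph n → (Fin n → Bool) → Set
Dense p q G S = ∀ v → S v ≡ true → suc q * (p * nonDeg G S v) ≤ q * count S

Σ-parts-≤ : ∀ p T (w : Fin p → Fin T → ℕ) {c} → (∀ i a → p * w i a ≤ c) →
  Σᶠ p (λ i → Σᶠ T (w i)) ≤ T * c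
Σ-parts-≤ zero      T w     le = z≤n
Σ-parts-≤ p@(suc _) T w {c} le = *-cancelˡ-≤ p (begin
  p * Σᶠ p (λ i → Σᶠ T (w i))              ≡⟨ trans (sym (Σ-*ˡ p p (λ i → Σᶠ T (w i)))) (Σ-cong p (λ i → sym (Σ-*ˡ T p (w i)))) ⟩
  Σᶠ p (λ i → Σᶠ T (λ a → p * w i a))      ≤⟨ Σ-mono p (λ i → Σ-mono T (le i)) ⟩
  Σᶠ p (λ _ → Σᶠ T (λ _ → c))              ≡⟨ trans (Σ-cong p (λ _ → Σ-const T c)) (Σ-const p _) ⟩
  p * (T * c)                              ∎)
  where open ≤-Reasoning

module _ {n} (G : Graph n) (S : Fin n → Bool) {p T} (M : Multipartite G S p T) where

  partNonDeg : Fin p → Fin n → ℕ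
  partNonDeg i v = Σᶠ T (λ a → na G (part M i a) v)

  totalNonDeg : ℕ
  totalNonDeg = Σᶠ p (λ i → Σᶠ T (λ a → nonDeg G S (part M i a)))

  totalNonDeg-swap : totalNonDeg ≡ Σᶠ n (λ v → ⟦ S v ⟧ * Σᶠ p (λ i → partNonDeg i v))
  totalNonDeg-swap = sym (begin
    Σᶠ n (λ v → ⟦ S v ⟧ * Σᶠ p (λ i → partNonDeg i v))
      ≡⟨ Σ-cong n (λ v → trans (sym (Σ-*ˡ p ⟦ S v ⟧ _)) (Σ-cong p (λ i → sym (Σ-*ˡ T ⟦ S v ⟧ _)))) ⟩
    Σᶠ n (λ v → Σᶠ p (λ i → Σᶠ T (λ a → ⟦ S v ⟧ * na G (part M i a) v)))
      ≡⟨ Σ-swap n p _ ⟩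
    Σᶠ p (λ i → Σᶠ n (λ v → Σᶠ T (λ a → ⟦ S v ⟧ * na G (part M i a) v)))
      ≡⟨ Σ-cong p (λ i → Σ-swap n T _) ⟩
    totalNonDeg ∎)
    where open ≡-Reasoning

  partNbrs : ∀ i v → count (λ a → adj G (part M i a) v) + partNonDeg i v ≡ T
  partNbrs i v = count-not (λ a → adj G (part M i a) v)

module _ {n} (G : Graph n) (S : Fin n → Bool) (P q t : ℕ) (dense : Dense P q G S)
         {p T} (p≤P : p ≤ P) (T≡ : T ≡ 2 * (suc q * suc t)) (M : Multipartite G S p T)
         (large : suc (2 * q) * (2 ^ (p * T) * suc t) ≤ count S) where

  private
    nd : Fin p → Fin n → ℕ
    nd = partNonDeg G S M

    good? : ∀ v → Dec (∀ i → nd i v + suc t ≤ T)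
    good? v = all? (λ i → nd i v + suc t ≤? T)

    Good Bad : Fin n → Bool
    Good v = S v ∧ does (good? v)
    Bad  v = S v ∧ not (does (good? v))

    -- c = T - (t + 1): a bad vertex misses more than this many vertices of some part.
    c : ℕ
    c = suc (2 * q) * suc t

    bad-≤ : ∀ v → ⟦ Bad v ⟧ * c ≤ ⟦ S v ⟧ * Σᶠ p (λ i → nd i v)
    bad-≤ v = ⟦⟧*-≤ (Bad v) λ bad →
      let v∈S , ¬good = ∧-true {S v} bad
          i , ¬le = ¬∀⟶∃¬ p _ (λ i → nd i v + suc t ≤? T) (does-false (good? v) (not-true ¬good))
      in begin
        c                               ≤⟨ ≤-from c (nd i v) 0 (<⇒≤ (≰⇒> ¬le))
                                             (trans (ident q t (nd i v)) (cong (nd i v +_) (sym T≡))) ⟩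
        nd i v                          ≤⟨ Σ-member p (λ i → nd i v) i ⟩
        Σᶠ p (λ i → nd i v)             ≡⟨ sym (⟦⟧*-true (S v) v∈S) ⟩
        ⟦ S v ⟧ * Σᶠ p (λ i → nd i v)   ∎
      where
      open ≤-Reasoning
      ident : ∀ q t x → suc (2 * q) * suc t + (x + suc t) + 0 ≡ x + 2 * (suc q * suc t)
      ident = solve-∀

    weighted : suc q * totalNonDeg G S M ≤ T * (q * count S)
    weighted = subst (_≤ T * (q * count S))
      (trans (Σ-cong p (λ i → Σ-*ˡ T (suc q) _)) (Σ-*ˡ p (suc q) _))
      (Σ-parts-≤ p T (λ i a → suc q * nonDeg G S (part M i a)) (λ i a → begin
        p * (suc q * nonDeg G S (part M i a))   ≤⟨ *-monoˡ-≤ _ p≤P ⟩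
        P * (suc q * nonDeg G S (part M i a))   ≡⟨ swap P (suc q) _ ⟩
        suc q * (P * nonDeg G S (part M i a))   ≤⟨ dense _ (inside M i a) ⟩
        q * count S                             ∎))
      where
      open ≤-Reasoning
      swap : ∀ x y z → x * (y * z) ≡ y * (x * z)
      swap = solve-∀

    -- Each part vertex has at most q|S|/((q + 1)P) non-neighbours in `S`, and a bad vertex accounts
    -- for `c` of all these pairs. The bound is T/c · q/(q + 1) = 2q/(2q + 1); without the factor 2
    -- in `T` it would be 1.
    bad-count : suc (2 * q) * count Bad ≤ 2 * q * count S
    bad-count = *-cancelˡ-≤ (suc q * suc t) (begin
      suc q * suc t * (suc (2 * q) * count Bad) ≡⟨ id₁ q t (count Bad) ⟩
      suc q * (count Bad * c)                   ≡⟨ cong (suc q *_) (sym (Σ-*ʳ n c _)) ⟩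
      suc q * Σᶠ n (λ v → ⟦ Bad v ⟧ * c)        ≤⟨ *-monoʳ-≤ (suc q) (Σ-mono n bad-≤) ⟩
      suc q * Σᶠ n (λ v → ⟦ S v ⟧ * Σᶠ p (λ i → nd i v))
                                                ≡⟨ cong (suc q *_) (sym (totalNonDeg-swap G S M)) ⟩
      suc q * totalNonDeg G S M                 ≤⟨ weighted ⟩
      T * (q * count S)                         ≡⟨ trans (cong (_* (q * count S)) T≡) (id₂ q t (count S)) ⟩
      suc q * suc t * (2 * q * count S)         ∎)
      where
      open ≤-Reasoning
      id₁ : ∀ q t b → suc q * suc t * (suc (2 * q) * b) ≡ suc q * (b * (suc (2 * q) * suc t))
      id₁ = solve-∀
      id₂ : ∀ q t k → 2 * (suc q * suc t) * (q * k) ≡ suc q * suc t * (2 * q * k)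
      id₂ = solve-∀

    good-count : 2 ^ (p * T) * suc t ≤ count Good
    good-count = *-cancelˡ-≤ (suc (2 * q)) (≤-trans large
      (≤-from (count S) (suc (2 * q) * count Good) 0 bad-count
        (trans (cong (λ k → k + 2 * q * k + 0) split)
        (trans (ident q (count Good) (count Bad))
          (refl)))))
      where
      split : count S ≡ count Good + count Bad
      split = count-split S (λ v → does (good? v))
      ident : ∀ q g b → (g + b) + 2 * q * (g + b) + 0 ≡ suc (2 * q) * g + suc (2 * q) * b
      ident = solve-∀

  -- Good vertices with the same adjacencies to all part vertices have the same neighbours in each
  -- part, and each part shrinks to `t` of these. Asking for t + 1 such vertices provides the
  -- representative `v₀` even when `t` is 0.
  addPart : Multipartite G S (suc p) t
  addPart with homogeneous (p * T) (λ c v → let i , a = remQuot {p} T c in adj G (part M i a) v)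
                 (suc t) Good good-count
  ... | A , A⊆Good , size , same = record
    { part = newPart ; inside = newInside ; part-injective = newInjective ; cross = newCross }
    where
    fresh : Σ (Fin t → Fin n) λ f → Injective′ f × (∀ a → A (f a) ≡ true)
    fresh = choose A (≤-trans (n≤1+n t) size)
    v₀ : Fin n
    v₀ = proj₁ (choose A size) zero
    v₀∈A : A v₀ ≡ true
    v₀∈A = proj₂ (proj₂ (choose A size)) zero
    sub : ∀ i → Σ (Fin t → Fin T) λ f → Injective′ f × (∀ a → adj G (part M i (f a)) v₀ ≡ true)
    sub i = choose (λ a → adj G (part M i a) v₀) (≤-trans (n≤1+n t)
      (+-cancelʳ-≤ (nd i v₀) _ _ (begin
        suc t + nd i v₀     ≡⟨ +-comm (suc t) _ ⟩
        nd i v₀ + suc t     ≤⟨ does-true (good? v₀) (proj₂ (∧-true {S v₀} (A⊆Good v₀ v₀∈A))) i ⟩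
        T                   ≡⟨ sym (partNbrs G S M i v₀) ⟩
        count (λ a → adj G (part M i a) v₀) + nd i v₀ ∎)))
      where open ≤-Reasoning
    joined : ∀ i a b → adj G (part M i (proj₁ (sub i) a)) (proj₁ fresh b) ≡ true
    joined i a b = trans
      (subst (λ { (i′ , a′) → adj G (part M i′ a′) (proj₁ fresh b) ≡ adj G (part M i′ a′) v₀ })
        (remQuot-combine i (proj₁ (sub i) a))
        (same (combine i (proj₁ (sub i) a)) _ v₀ (proj₂ (proj₂ fresh) b) v₀∈A))
      (proj₂ (proj₂ (sub i)) a)
    newPart : Fin (suc p) → Fin t → Fin n
    newPart zero    a = proj₁ fresh a
    newPart (suc i) a = part M i (proj₁ (sub i) a)
    newInside : ∀ i a → S (newPart i a) ≡ true
    newInside zero    a = proj₁ (∧-true (A⊆Good _ (proj₂ (proj₂ fresh) a)))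
    newInside (suc i) a = inside M i _
    newInjective : ∀ i → Injective′ (newPart i)
    newInjective zero    eq = proj₁ (proj₂ fresh) eq
    newInjective (suc i) eq = proj₁ (proj₂ (sub i)) (part-injective M i eq)
    newCross : ∀ {i j} → i ≢ j → ∀ a b → adj G (newPart i a) (newPart j b) ≡ true
    newCross {zero}  {zero}  ne a b = ⊥-elim (ne refl)
    newCross {zero}  {suc j} ne a b = trans (adjSym G _ _) (joined j b a)
    newCross {suc i} {zero}  ne a b = joined i a b
    newCross {suc i} {suc j} ne a b = cross M (ne ∘ cong suc) _ _

-- The density parameter `P` stays fixed while `p` grows, so that one `Dense` hypothesis serves
-- every stage of the induction.
erdősStone-minDegree : ∀ P q p t → p ≤ suc P → ∃ λ M → ∀ {n} (G : Graph n) S →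
  Dense P q G S → M ≤ count S → Multipartite G S p t
erdősStone-minDegree P q zero t p≤ = 0 , λ G S _ _ → record
  { part = λ () ; inside = λ () ; part-injective = λ () ; cross = λ { {()} } }
erdősStone-minDegree P q (suc p) t (s≤s p≤P) =
  M + suc (2 * q) * (2 ^ (p * T) * suc t) , λ G S dense large →
    addPart G S P q t dense p≤P refl (multi G S dense (≤-trans (m≤m+n M _) large))
      (≤-trans (m≤n+m _ M) large)
  where
  T M : ℕ
  T = 2 * (suc q * suc t)
  M = proj₁ (erdősStone-minDegree P q p T (m≤n⇒m≤1+n p≤P))
  multi : ∀ {n} (G : Graph n) S → Dense P q G S → M ≤ count S → Multipartite G S p T
  multi = proj₂ (erdősStone-minDegree P q p T (m≤n⇒m≤1+n p≤P))

widen : ∀ {n} {G : Graph n} {S S′ : Fin n → Bool} {r t} →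
  (∀ v → S v ≡ true → S′ v ≡ true) → Multipartite G S r t → Multipartite G S′ r t
widen sub M = record
  { part = part M ; inside = λ i a → sub _ (inside M i a)
  ; part-injective = part-injective M ; cross = cross M }

-- Deleting a vertex that violates the density condition preserves the inequality on nonEdges.
densify : ∀ {n} (G : Graph n) P q M k S → count S ≡ k →
  P * suc q * nonEdges G S + P * suc q * k + suc (q * (M * M)) ≤ q * (k * k) →
  Σ (Fin n → Bool) λ S′ → (∀ v → S′ v ≡ true → S v ≡ true) × Dense P q G S′ × M ≤ count S′
densify G P q M k S k≡ inv
  with any? (λ v → S v ≟ᵇ true ×-dec q * count S <? suc q * (P * nonDeg G S v))
-- Once no vertex violates the condition, the constant `suc (q * (M * M))` in the invariant rules
-- out |S| < M.
... | no none = S , (λ _ v∈ → v∈) , (λ v v∈ → ≮⇒≥ λ lt → none (v , v∈ , lt)) ,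
  ≮⇒≥ λ small → <-irrefl refl (begin-strict
    q * (k * k)         ≤⟨ *-monoʳ-≤ q (*-mono-≤ (k≤M small) (k≤M small)) ⟩
    q * (M * M)         <⟨ m≤n+m _ _ ⟩
    P * suc q * nonEdges G S + P * suc q * k + suc (q * (M * M)) ≤⟨ inv ⟩
    q * (k * k)         ∎)
  where
  open ≤-Reasoning
  k≤M : count S < M → k ≤ M
  k≤M lt = ≤-trans (≤-reflexive (sym k≡)) (<⇒≤ lt)
densify G P q M zero S k≡ inv | yes (v , v∈ , viol)
  with trans (sym k≡) (count-remove S v v∈)
... | ()
densify G P q M (suc k) S k≡ inv | yes (v , v∈ , viol) =
  let S′ , sub , rest = densify G P q M k (remove S v) size step in
  S′ , (λ w w∈ → proj₁ (∧-true (sub w w∈))) , rest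
  where
  size : count (remove S v) ≡ k
  size = cong (_∸ 1) (trans (sym (count-remove S v v∈)) k≡)
  E E′ d B : ℕ
  E  = nonEdges G S
  E′ = nonEdges G (remove S v)
  d  = nonDeg G S v
  B  = suc (q * (M * M))
  viol′ : suc (q * suc k) ≤ suc q * (P * d)
  viol′ = subst (λ x → suc (q * x) ≤ suc q * (P * d)) k≡ viol
  id₂ : ∀ P q E′ k B d → (P * suc q * E′ + P * suc q * k + B) + (q * (suc k * suc k) + 2 * (suc q * (P * d))) + (q + 2)
        ≡ q * (k * k) + (P * suc q * (E′ + 2 * d) + P * suc q * k + B + 2 * suc (q * suc k))
  id₂ = solve-∀
  -- The linear term drops by P(q + 1) as k + 1 becomes k, which pays for the 1 in
  -- `nonEdges-remove`.
  step : P * suc q * E′ + P * suc q * k + B ≤ q * (k * k)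
  step = ≤-from _ _ (q + 2)
    (+-mono-≤ (≤-trans (≤-reflexive (trans (cong (λ x → P * suc q * x + P * suc q * k + B)
                 (sym (nonEdges-remove G S v v∈))) (id₁ P q E k B))) inv)
              (*-monoʳ-≤ 2 viol′))
    (id₂ P q E′ k B d)
    where
    id₁ : ∀ P q E k B → P * suc q * (E + 1) + P * suc q * k + B
        ≡ P * suc q * E + P * suc q * suc k + B
    id₁ = solve-∀

erdősStone : ∀ P q t → ∃ λ B → ∀ {n} (G : Graph n) S →
  P * suc q * nonEdges G S + P * suc q * count S + B ≤ q * (count S * count S) →
  Multipartite G S (suc P) t
erdősStone P q t = suc (q * (M * M)) , λ G S inv →
  let S′ , sub , dense , large = densify G P q M (count S) S refl inv in
  widen sub (multi G S′ dense large)
  where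
  M : ℕ
  M = proj₁ (erdősStone-minDegree P q (suc P) t ≤-refl)
  multi : ∀ {n} (G : Graph n) S → Dense P q G S → M ≤ count S → Multipartite G S (suc P) t
  multi = proj₂ (erdősStone-minDegree P q (suc P) t ≤-refl)

-- Dense neighbourhoods of vertices with few non-neighbours

nonDegree : ∀ {n} → Graph n → Fin n → ℕ
nonDegree G = nonDeg G (λ _ → true)

nonEdgesAll : ∀ {n} → Graph n → ℕ
nonEdgesAll G = nonEdges G (λ _ → true)

-- The Turán graph attains n²/r up to rounding of its class sizes, which the term `r * n` absorbs.
TuránDense : ∀ {n} → ℕ → Graph n → Set
TuránDense {n} r G = r * nonEdgesAll G ≤ n * n + r * n

degree+nonDegree : ∀ {n} (G : Graph n) v → count (adj G v) + nonDegree G v ≡ n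
degree+nonDegree {n} G v = trans
  (cong (count (adj G v) +_) (Σ-cong n (λ j → *-identityˡ (na G v j)))) (count-not (adj G v))

form-≤ : ∀ {n} (M : Fin n → Fin n → ℕ) → (∀ i j → M i j ≤ 1) → ∀ f g →
  form M f g ≤ Σᶠ n f * Σᶠ n g
form-≤ {n} M M≤1 f g = begin
  form M f g                       ≤⟨ Σ-mono n (λ i → *-monoʳ-≤ (f i) (Σ-mono n (λ j → *-monoʳ-≤ (g j) (M≤1 i j)))) ⟩
  Σᶠ n (λ i → f i * Σᶠ n (λ j → g j * 1)) ≡⟨ Σ-cong n (λ i → cong (f i *_) (Σ-cong n (λ j → *-identityʳ (g j)))) ⟩
  Σᶠ n (λ i → f i * Σᶠ n g)        ≡⟨ Σ-*ʳ n (Σᶠ n g) f ⟩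
  Σᶠ n f * Σᶠ n g                  ∎
  where open ≤-Reasoning

-- The non-edges meeting the b non-neighbours of v are at least 2ab − b² − 2ah in number.
nonEdges-nbhd : ∀ {n} (G : Graph n) a h v → count (λ u → does (nonDegree G u <? a)) ≤ h →
  nonDegree G v ≤ a →
  nonEdges G (adj G v) + nonDegree G v * nonDegree G v ≤ nonEdgesAll G + 2 * (a * h)
nonEdges-nbhd {n} G a h v few b≤a =
  ≤-from _ _ 0
    (+-mono-≤ (≤-reflexive split)
      (+-mono-≤ Y≤b² (+-mono-≤ (*-monoʳ-≤ 2 ab≤) (*-monoʳ-≤ 2 (*-monoˡ-≤ b b≤a)))))
    (ident (nonEdges G (adj G v)) (nonEdgesAll G) X Y a h b)
  where
  N̄ : Fin n → ℕ
  N̄ u = na G v u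
  b X Y : ℕ
  b = nonDegree G v
  X = form (na G) N̄ (λ _ → 1)
  Y = form (na G) N̄ N̄
  ΣN̄ : Σᶠ n N̄ ≡ b
  ΣN̄ = Σ-cong n (λ j → sym (*-identityˡ (N̄ j)))
  split : nonEdges G (adj G v) + 2 * X ≡ nonEdgesAll G + Y
  split = sym (form-split (na G) (na-sym G) (λ _ → 1) (⟦_⟧ ∘ adj G v) N̄ (λ u → sym (⟦not⟧ (adj G v u))))
  Y≤b² : Y ≤ b * b
  Y≤b² = ≤-trans (form-≤ (na G) (λ i j → ⟦⟧≤1 _) N̄ N̄) (≤-reflexive (cong₂ _*_ ΣN̄ ΣN̄))
  low : Fin n → ℕ
  low u = ⟦ does (nonDegree G u <? a) ⟧
  pointwise : ∀ u → N̄ u * a ≤ N̄ u * nonDegree G u + a * low u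
  pointwise u with nonDegree G u <? a
  ... | no ¬lt = ≤-trans (*-monoʳ-≤ (N̄ u) (≮⇒≥ ¬lt)) (m≤m+n _ _)
  ... | yes lt = begin
    N̄ u * a                            ≤⟨ *-monoˡ-≤ a (⟦⟧≤1 (not (adj G v u))) ⟩
    1 * a                              ≡⟨ *-comm 1 a ⟩
    a * 1                              ≡⟨ cong (λ x → a * ⟦ x ⟧) (sym (dec-true (nonDegree G u <? a) lt)) ⟩
    a * low u                          ≤⟨ m≤n+m _ (N̄ u * nonDegree G u) ⟩
    N̄ u * nonDegree G u + a * low u    ∎
    where open ≤-Reasoning
  ab≤ : b * a ≤ X + a * h
  ab≤ = begin
    b * a                             ≡⟨ cong (_* a) (sym ΣN̄) ⟩
    Σᶠ n N̄ * a                        ≡⟨ sym (Σ-*ʳ n a N̄) ⟩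
    Σᶠ n (λ u → N̄ u * a)              ≤⟨ Σ-mono n pointwise ⟩
    Σᶠ n (λ u → N̄ u * nonDegree G u + a * low u) ≡⟨ trans (Σ-+ n _ _) (cong (X +_) (Σ-*ˡ n a low)) ⟩
    X + a * Σᶠ n low                  ≤⟨ +-monoʳ-≤ X (*-monoʳ-≤ a few) ⟩
    X + a * h                         ∎
    where open ≤-Reasoning
  ident : ∀ e E X Y a h b → (e + b * b) + ((E + Y) + (b * b + (2 * (X + a * h) + 2 * (a * b)))) + 0
          ≡ (E + 2 * (a * h)) + ((e + 2 * X) + (Y + (2 * (b * a) + 2 * (b * b))))
  ident = solve-∀

module _ (p q₀ h t : ℕ) where

  -- With b non-neighbours of v, k = n − b and y = n − rb, the identity r k² + p r b² = p n² + y²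
  -- leaves a surplus of order y² ≥ n²/(q₀ + 1)²; hence the choice q + 1 = (r + 1)(q₀ + 1)².
  private
    r z q c w B : ℕ
    r = suc p
    z = q₀ + q₀ * suc q₀
    q = z + r * suc z
    c = r + 2 * (r * h)
    w = p * suc q
    B = proj₁ (erdősStone p q t)

    -- The surplus (q + 1)y² covers r + 1 copies of n². Since k ≤ n, `r` of them turn (q + 1)rk²
    -- into qrk²; the last one absorbs the linear and constant terms.
    conclude : ∀ e K N Y b n k → w * (r * e + r * b) ≤ w * (N + c * n) → suc r * N ≤ suc q * Y →
      (w * c + r * w) * n + r * B ≤ N → k ≤ n → K ≤ N → w * N + suc q * Y ≤ suc q * (r * K) + w * (r * b) →
      w * e + w * k + B ≤ q * K
    conclude e K N Y b n k hA hB hC hk hK hI = *-cancelˡ-≤ r (≤-from _ _ 0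
      (+-mono-≤ hA (+-mono-≤ hB (+-mono-≤ hC (+-mono-≤ (*-monoʳ-≤ (r * w) hk) (+-mono-≤ (*-monoʳ-≤ r hK) hI)))))
      (ident w r e b N c n q Y B k K))
      where
      ident : ∀ w r e b N c n q Y B k K →
        r * (w * e + w * k + B) + (w * (N + c * n) + (suc q * Y + (N + (r * w * n + (r * N + (suc q * (r * K) + w * (r * b))))))) + 0
        ≡ r * (q * K) + (w * (r * e + r * b) + (suc r * N + ((w * c + r * w) * n + r * B + (r * w * k + (r * K + (w * N + suc q * Y))))))
      ident = solve-∀

  heavyThreshold : ℕ
  heavyThreshold = suc ((w * c + r * w) + r * B)

  -- By `nonEdges-nbhd` the neighbourhood spans at most n²/r - b² non-adjacent pairs up to linear
  -- terms. For r ≥ 2 this lies below the Erdős-Stone threshold (n - b)²/(r - 1) by about y²/(r(r -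
  -- 1)), which is quadratic in `n` as long as `b` stays away from n/r.
  heavyMultipartite : ∀ {n} (G : Graph n) a v → heavyThreshold ≤ n → TuránDense r G →
    count (λ u → does (nonDegree G u <? a)) ≤ h → a ≤ n → nonDegree G v ≤ a →
    suc q₀ * (r * nonDegree G v) ≤ q₀ * n → Multipartite G (adj G v) r t
  heavyMultipartite {n} G a v large turán few a≤n b≤a heavy =
    proj₂ (erdősStone p q t) G (adj G v)
      (conclude e (k * k) (n * n) (y * y) (b * b) n k hA hB hC k≤n (*-mono-≤ k≤n k≤n) (≤-reflexive hI))
    where
    e k b y : ℕ
    e = nonEdges G (adj G v)
    k = count (adj G v)
    b = nonDegree G v
    y = n ∸ r * b
    k+b : k + b ≡ n
    k+b = degree+nonDegree G v
    k≤n : k ≤ n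
    k≤n = count≤n (adj G v)
    rb≤n : r * b ≤ n
    rb≤n = *-cancelˡ-≤ (suc q₀) (≤-trans heavy (*-monoˡ-≤ n (n≤1+n q₀)))
    y+rb : y + r * b ≡ n
    y+rb = m∸n+n≡m rb≤n
    k≡ : k ≡ y + p * b
    k≡ = +-cancelʳ-≡ b k (y + p * b) (trans k+b (trans (sym y+rb) (ident y p b)))
      where
      ident : ∀ y p b → y + suc p * b ≡ y + p * b + b
      ident = solve-∀
    hA : w * (r * e + r * (b * b)) ≤ w * (n * n + c * n)
    hA = *-monoʳ-≤ w (begin
      r * e + r * (b * b)                    ≡⟨ sym (*-distribˡ-+ r e (b * b)) ⟩
      r * (e + b * b)                        ≤⟨ *-monoʳ-≤ r (nonEdges-nbhd G a h v few b≤a) ⟩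
      r * (nonEdgesAll G + 2 * (a * h))      ≡⟨ *-distribˡ-+ r (nonEdgesAll G) _ ⟩
      r * nonEdgesAll G + r * (2 * (a * h))  ≤⟨ +-mono-≤ turán (*-monoʳ-≤ r (*-monoʳ-≤ 2 (*-monoˡ-≤ h a≤n))) ⟩
      n * n + r * n + r * (2 * (n * h))      ≡⟨ ident n r h ⟩
      n * n + c * n                          ∎)
      where
      open ≤-Reasoning
      ident : ∀ n r h → n * n + r * n + r * (2 * (n * h)) ≡ n * n + (r + 2 * (r * h)) * n
      ident = solve-∀
    n≤y : n ≤ suc q₀ * y
    n≤y = ≤-from _ _ 0 heavy (begin
      n + q₀ * n + 0                          ≡⟨ +-identityʳ _ ⟩
      suc q₀ * n                              ≡⟨ cong (suc q₀ *_) (sym y+rb) ⟩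
      suc q₀ * (y + r * b)                    ≡⟨ *-distribˡ-+ (suc q₀) y (r * b) ⟩
      suc q₀ * y + suc q₀ * (r * b)           ∎)
      where open ≡-Reasoning
    hB : suc r * (n * n) ≤ suc q * (y * y)
    hB = begin
      suc r * (n * n)                         ≤⟨ *-monoʳ-≤ (suc r) (*-mono-≤ n≤y n≤y) ⟩
      suc r * (suc q₀ * y * (suc q₀ * y))     ≡⟨ ident r (suc q₀) y ⟩
      suc r * (suc q₀ * suc q₀) * (y * y)     ∎
      where
      open ≤-Reasoning
      ident : ∀ r s y → suc r * (s * y * (s * y)) ≡ suc r * (s * s) * (y * y)
      ident = solve-∀
    hC : (w * c + r * w) * n + r * B ≤ n * n
    hC = begin
      (w * c + r * w) * n + r * B             ≤⟨ +-monoʳ-≤ ((w * c + r * w) * n) (m≤m*n (r * B) n) ⟩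
      (w * c + r * w) * n + r * B * n         ≡⟨ sym (*-distribʳ-+ n (w * c + r * w) (r * B)) ⟩
      ((w * c + r * w) + r * B) * n           ≤⟨ *-monoˡ-≤ n (≤-trans (n≤1+n _) large) ⟩
      n * n                                   ∎
      where
      open ≤-Reasoning
      instance
        n≢0 : NonZero n
        n≢0 = >-nonZero (≤-trans (s≤s z≤n) large)
    hI : w * (n * n) + suc q * (y * y) ≡ suc q * (r * (k * k)) + w * (r * (b * b))
    hI = ident p (suc q) y b y+rb k≡
      where
      ident′ : ∀ p s y b → p * s * ((y + suc p * b) * (y + suc p * b)) + s * (y * y)
        ≡ s * (suc p * ((y + p * b) * (y + p * b))) + p * s * (suc p * (b * b))
      ident′ = solve-∀
      ident : ∀ p s y b {n k} → y + suc p * b ≡ n → k ≡ y + p * b →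
        p * s * (n * n) + s * (y * y) ≡ s * (suc p * (k * k)) + p * s * (suc p * (b * b))
      ident p s y b refl refl = ident′ p s y b

-- The bound is lowered as long as at least `c` vertices satisfy it. This yields the condition of
-- `nonEdges-nbhd` that few vertices lie strictly below the cut-off, however many satisfy d ≤ a₀.
threshold : ∀ {n} (d : Fin n → ℕ) c a₀ → c ≤ count (λ u → does (d u ≤? a₀)) →
  ∃ λ a → a ≤ a₀ × c ≤ count (λ u → does (d u ≤? a)) × count (λ u → does (d u <? a)) ≤ c
threshold {n} d c zero le = 0 , z≤n , le , ≤-trans (≤-reflexive none) z≤n
  where
  none : count (λ u → does (d u <? 0)) ≡ 0
  none = trans (Σ-cong n (λ u → cong ⟦_⟧ (dec-false (d u <? 0) λ ()))) (Σ-zero n)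
threshold {n} d c (suc a₀) le with c ≤? count (λ u → does (d u ≤? a₀))
... | yes le′ = let a , a≤ , rest = threshold d c a₀ le′ in a , m≤n⇒m≤1+n a≤ , rest
... | no ¬le  = suc a₀ , ≤-refl , le , ≤-trans (count-mono below) (<⇒≤ (≰⇒> ¬le))
  where
  below : ∀ u → does (d u <? suc a₀) ≡ true → does (d u ≤? a₀) ≡ true
  below u lt = dec-true (d u ≤? a₀) (≤-pred (does-true (d u <? suc a₀) lt))

-- Vertex-critical graphs

record Apex {k} (F : Graph k) (r : ℕ) : Set where
  field
    apex   : Fin k
    colour : Fin k → Fin r
    proper : ∀ i j → i ≢ apex → j ≢ apex → adj F i j ≡ true → colour i ≢ colour j
    ¬colourable : ¬ Colourable F r
open Apex public

chromatic-unique : ∀ {k} {F : Graph k} {c d} → ChromaticNumber F c → ChromaticNumber F d → c ≡ d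
chromatic-unique (col , min) (col′ , min′) = ≤-antisym (min _ col′) (min′ _ col)

vertexCritical⇒apex : ∀ {k} (F : Graph k) p → VertexCritical F → ChromaticNumber F (suc (suc p)) →
  Apex F (suc p)
vertexCritical⇒apex {suc k} F p (c , χ , u , χ′) χF with chromatic-unique {F = F} χ χF
... | refl = record
  { apex = u ; colour = col ; proper = prop ; ¬colourable = λ colF → 1+n≰n (proj₂ χF (suc p) colF) }
  where
  col : Fin (suc k) → Fin (suc p)
  col i with u ≟ i
  -- A filler colour for the deleted vertex, which `proper` excludes.
  ... | yes _  = zero
  ... | no u≢i = proj₁ (proj₁ χ′) (punchOut u≢i)
  prop : ∀ i j → i ≢ u → j ≢ u → adj F i j ≡ true → col i ≢ col j
  prop i j i≢u j≢u ij with u ≟ i | u ≟ j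
  ... | yes eq  | _       = ⊥-elim (i≢u (sym eq))
  ... | no _    | yes eq  = ⊥-elim (j≢u (sym eq))
  ... | no u≢i  | no u≢j  = proj₂ (proj₁ χ′) (punchOut u≢i) (punchOut u≢j)
    (trans (cong₂ (adj F) (punchIn-punchOut u≢i) (punchIn-punchOut u≢j)) ij)

-- Vertex `i` takes position `i` in the part of its colour, so injectivity inside a part is
-- immediate; this is why the parts have size `k`. The location of the image is recorded in order to
-- keep several copies disjoint.
apex-embed : ∀ {k n r} {F : Graph k} (A : Apex F r) (G : Graph n) w {S : Fin n → Bool} →
  (∀ x → S x ≡ true → adj G w x ≡ true) → Multipartite G S r k →
  Σ (F ⊆ G) λ f → ∀ i → proj₁ f i ≡ w ⊎ S (proj₁ f i) ≡ true
apex-embed {k} {n} {r} {F} A G w {S} nbr M = (f , f-inj , f-hom) , f-in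
  where
  f : Fin k → Fin n
  f i with i ≟ apex A
  ... | yes _ = w
  ... | no _  = part M (colour A i) i
  f-in : ∀ i → f i ≡ w ⊎ S (f i) ≡ true
  f-in i with i ≟ apex A
  ... | yes _ = inj₁ refl
  ... | no _  = inj₂ (inside M _ i)
  w≢ : ∀ i a → w ≢ part M i a
  w≢ i a eq = true≢false (nbr _ (inside M i a)) (trans (cong (adj G w) (sym eq)) (irrefl G w))
  f-inj : Injective′ f
  f-inj {i} {j} eq with i ≟ apex A | j ≟ apex A
  ... | yes i≡ | yes j≡ = trans i≡ (sym j≡)
  ... | yes _  | no _   = ⊥-elim (w≢ _ _ eq)
  ... | no _   | yes _  = ⊥-elim (w≢ _ _ (sym eq))
  ... | no _   | no _ with colour A i ≟ colour A j
  ...   | yes same = part-injective M (colour A i) (trans eq (cong (λ c → part M c j) (sym same)))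
  ...   | no diff  = ⊥-elim (true≢false (cross M diff i j)
                       (trans (cong (λ x → adj G x (part M (colour A j) j)) eq) (irrefl G _)))
  f-hom : ∀ i j → adj F i j ≡ true → adj G (f i) (f j) ≡ true
  f-hom i j ij with i ≟ apex A | j ≟ apex A
  ... | yes refl | yes refl = ⊥-elim (true≢false ij (irrefl F i))
  ... | yes _    | no _     = nbr _ (inside M _ j)
  ... | no _     | yes _    = trans (adjSym G _ _) (nbr _ (inside M _ i))
  ... | no i≢    | no j≢    = cross M (proper A i j i≢ j≢ ij) i j

avoid : ∀ {n} {G : Graph n} {S : Fin n → Bool} {r t T} (Z : Fin n → Bool) → t + count Z ≤ T →
  Multipartite G S r T → Multipartite G (λ v → S v ∧ not (Z v)) r t
avoid {n} {G} {S} {r} {t} {T} Z le M = record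
  { part   = λ i a → part M i (proj₁ (sub i) a)
  ; inside = λ i a → cong₂ _∧_ (inside M i _) (proj₂ (proj₂ (sub i)) a)
  ; part-injective = λ i eq → proj₁ (proj₂ (sub i)) (part-injective M i eq)
  ; cross  = λ ne a b → cross M ne _ _ }
  where
  sub : ∀ i → Σ (Fin t → Fin T) λ f → Injective′ f × (∀ a → not (Z (part M i (f a))) ≡ true)
  sub i = choose (λ a → not (Z (part M i a))) (+-cancelʳ-≤ (count Z) t _ (begin
    t + count Z                     ≤⟨ le ⟩
    T                               ≡⟨ sym (count-not (Z ∘ part M i)) ⟩
    count (Z ∘ part M i) + count (λ a → not (Z (part M i a)))
                                    ≤⟨ +-monoˡ-≤ _ (Σ-injective (part M i) (part-injective M i) (⟦_⟧ ∘ Z)) ⟩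
    count Z + count (λ a → not (Z (part M i a))) ≡⟨ +-comm (count Z) _ ⟩
    count (λ a → not (Z (part M i a))) + count Z ∎))
    where open ≤-Reasoning

indicator : ∀ b → (if b then 1 else 0) ≡ ⟦ b ⟧
indicator true  = refl
indicator false = refl

Σ-++ : ∀ m k (f : Fin (m + k) → ℕ) → Σᶠ (m + k) f ≡ Σᶠ m (λ i → f (i ↑ˡ k)) + Σᶠ k (λ i → f (m ↑ʳ i))
Σ-++ zero    k f = refl
Σ-++ (suc m) k f = trans (cong (f zero +_) (Σ-++ m k (f ∘ suc))) (sym (+-assoc (f zero) _ _))

Σ-combine : ∀ B k (f : Fin (B * k) → ℕ) → Σᶠ (B * k) f ≡ Σᶠ B (λ b → Σᶠ k (λ c → f (combine b c)))
Σ-combine zero    k f = refl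
Σ-combine (suc B) k f = trans (Σ-++ k (B * k) f)
  (cong (Σᶠ k (λ c → f (c ↑ˡ (B * k))) +_) (Σ-combine B k (λ i → f (k ↑ʳ i))))

-- Edge counts

adjSum : ∀ {n} → Graph n → ℕ
adjSum {n} G = Σᶠ n (λ i → Σᶠ n (λ j → ⟦ adj G i j ⟧))

handshake : ∀ {n} (G : Graph n) → edges G + edges G ≡ adjSum G
handshake {n} G = begin
  edges G + edges G
    ≡⟨ cong₂ _+_ upper (trans upper (Σ-swap n n up)) ⟩
  Σᶠ n (λ i → Σᶠ n (up i)) + Σᶠ n (λ i → Σᶠ n (λ j → up j i))
    ≡⟨ trans (sym (Σ-+ n _ _)) (Σ-cong n (λ i → sym (Σ-+ n _ _))) ⟩
  Σᶠ n (λ i → Σᶠ n (λ j → up i j + up j i))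
    ≡⟨ Σ-cong n (λ i → Σ-cong n (λ j → both i j)) ⟩
  adjSum G ∎
  where
  open ≡-Reasoning
  up : Fin n → Fin n → ℕ
  up i j = ⟦ (toℕ i <ᵇ toℕ j) ∧ adj G i j ⟧
  upper : edges G ≡ Σᶠ n (λ i → Σᶠ n (up i))
  upper = Σ-cong n (λ i → Σ-cong n (λ j → indicator _))
  both : ∀ i j → up i j + up j i ≡ ⟦ adj G i j ⟧
  both i j with <-cmp (toℕ i) (toℕ j)
  ... | tri< lt _ ¬gt
    rewrite dec-true (toℕ i <? toℕ j) lt | dec-false (toℕ j <? toℕ i) ¬gt = +-identityʳ _
  ... | tri> ¬lt _ gt
    rewrite dec-false (toℕ i <? toℕ j) ¬lt | dec-true (toℕ j <? toℕ i) gt = cong ⟦_⟧ (adjSym G j i)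
  ... | tri≈ ¬lt eq ¬gt
    rewrite dec-false (toℕ i <? toℕ j) ¬lt | dec-false (toℕ j <? toℕ i) ¬gt | toℕ-injective eq =
    cong ⟦_⟧ (sym (irrefl G j))

nonEdges+edges : ∀ {n} (G : Graph n) → nonEdgesAll G + (edges G + edges G) ≡ n * n
nonEdges+edges {n} G = begin
  nonEdgesAll G + (edges G + edges G)
    ≡⟨ cong₂ _+_ (Σ-cong n (λ i → trans (*-identityˡ _) (Σ-cong n (λ j → *-identityˡ _)))) (handshake G) ⟩
  Σᶠ n (λ i → Σᶠ n (na G i)) + adjSum G
    ≡⟨ trans (sym (Σ-+ n _ _)) (Σ-cong n (λ i → sym (Σ-+ n _ _))) ⟩
  Σᶠ n (λ i → Σᶠ n (λ j → na G i j + ⟦ adj G i j ⟧))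
    ≡⟨ Σ-cong n (λ i → Σ-cong n (λ j → trans (+-comm (na G i j) _) (⟦not⟧ (adj G i j)))) ⟩
  Σᶠ n (λ i → Σᶠ n (λ j → 1))
    ≡⟨ trans (Σ-cong n (λ i → trans (Σ-const n 1) (*-identityʳ n))) (Σ-const n n) ⟩
  n * n ∎
  where open ≡-Reasoning

double-cancel-≤ : ∀ {a b} → a + a ≤ b + b → a ≤ b
double-cancel-≤ le = ≮⇒≥ λ lt → <⇒≱ (+-mono-< lt lt) le

double-cancel-≡ : ∀ {a b} → a + a ≡ b + b → a ≡ b
double-cancel-≡ eq =
  ≤-antisym (double-cancel-≤ (≤-reflexive eq)) (double-cancel-≤ (≤-reflexive (sym eq)))

edges-mono : ∀ {n} (A B : Graph n) → (∀ i j → adj A i j ≡ true → adj B i j ≡ true) →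
  edges A ≤ edges B
edges-mono {n} A B sub = double-cancel-≤ (subst₂ _≤_ (sym (handshake A)) (sym (handshake B))
  (Σ-mono n (λ i → Σ-mono n (λ j → ⟦⟧-≤ (sub i j)))))

edges-tight : ∀ {n} (A B : Graph n) → (∀ i j → adj A i j ≡ true → adj B i j ≡ true) →
  edges B ≤ edges A → ∀ i j → adj A i j ≡ adj B i j
edges-tight {n} A B sub le i j with adj A i j in a | adj B i j in b
... | true  | true  = refl
... | false | false = refl
... | true  | false = ⊥-elim (true≢false (sub i j a) b)
... | false | true  = ⊥-elim (<-irrefl refl (begin-strict
  adjSum A           <⟨ m<m+n (adjSum A) (s≤s z≤n) ⟩
  adjSum A + 1       ≤⟨ Σ-mono-extra n i (λ i′ → Σ-mono n (λ j′ → ⟦⟧-≤ (sub i′ j′)))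
                          (Σ-mono-extra n j (λ j′ → ⟦⟧-≤ (sub i j′)) here) ⟩
  adjSum B + 0       ≡⟨ +-identityʳ _ ⟩
  adjSum B           ≡⟨ sym (handshake B) ⟩
  edges B + edges B  ≤⟨ +-mono-≤ le le ⟩
  edges A + edges A  ≡⟨ handshake A ⟩
  adjSum A           ∎))
  where
  open ≤-Reasoning
  here : ⟦ adj A i j ⟧ + 1 ≤ ⟦ adj B i j ⟧ + 0
  here rewrite a | b = ≤-refl

pullback : ∀ {m n} → Graph n → (Fin m → Fin n) → Graph m
pullback G f = record
  { adj    = λ i j → adj G (f i) (f j)
  ; adjSym = λ i j → adjSym G (f i) (f j)
  ; irrefl = λ i → irrefl G (f i) }

Σ-bijective : ∀ {m n} (f : Fin m → Fin n) → Injective′ f → (∀ i → ∃ λ a → f a ≡ i) → (g : Fin n → ℕ) →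
  Σᶠ m (g ∘ f) ≡ Σᶠ n g
Σ-bijective {m} {n} f inj surj g = trans (sym (Σ-img f inj g)) (Σ-cong n (λ i →
  let a , eq = surj i in ⟦⟧*-true (img f i) (subst (λ x → img f x ≡ true) eq (img-∈ f a))))

edges-pullback : ∀ {m n} (G : Graph n) (f : Fin m → Fin n) → Injective′ f → (∀ i → ∃ λ a → f a ≡ i) →
  edges (pullback G f) ≡ edges G
edges-pullback {m} {n} G f inj surj = double-cancel-≡ (begin
  edges (pullback G f) + edges (pullback G f)        ≡⟨ handshake (pullback G f) ⟩
  Σᶠ m (λ i → Σᶠ m (λ j → ⟦ adj G (f i) (f j) ⟧))    ≡⟨ Σ-cong m (λ i → Σ-bijective f inj surj (λ j → ⟦ adj G (f i) j ⟧)) ⟩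
  Σᶠ m (λ i → Σᶠ n (λ j → ⟦ adj G (f i) j ⟧))        ≡⟨ Σ-bijective f inj surj (λ i → Σᶠ n (λ j → ⟦ adj G i j ⟧)) ⟩
  adjSum G                                           ≡⟨ sym (handshake G) ⟩
  edges G + edges G                                  ∎)
  where open ≡-Reasoning

≅⇒edges : ∀ {m n} (A : Graph m) (B : Graph n) → A ≅ B → edges A ≡ edges B
≅⇒edges A B (f , (inj , surj) , eq) = trans
  (≤-antisym (edges-mono A (pullback B f) (λ i j p → trans (sym (eq i j)) p))
             (edges-mono (pullback B f) A (λ i j p → trans (eq i j) p)))
  (edges-pullback B f inj (λ i → proj₁ (surj i) , proj₂ (surj i) refl))

castGraph : ∀ {m n} → m ≡ n → Graph m → Graph n
castGraph refl G = G

edges-cast : ∀ {m n} (eq : m ≡ n) (G : Graph m) → edges (castGraph eq G) ≡ edges G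
edges-cast refl G = refl

⊆-uncast : ∀ {k m n} (eq : m ≡ n) {F : Graph k} (G : Graph m) → F ⊆ castGraph eq G → F ⊆ G
⊆-uncast refl G sub = sub

⊆-pullback : ∀ {k m n} {F : Graph k} (G : Graph n) (e : Fin m → Fin n) → Injective′ e →
  ((f , _) : F ⊆ pullback G e) → Σ (F ⊆ G) λ g → ∀ i → proj₁ g i ≡ e (f i)
⊆-pullback G e inj (f , f-inj , f-hom) = (e ∘ f , f-inj ∘ inj , f-hom) , λ _ → refl

double-choose : ∀ j → 2 * (j C 2) + j ≡ j * j
double-choose zero    = refl
double-choose (suc j) = begin
  2 * (suc j C 2) + suc j       ≡⟨ cong (λ x → 2 * x + suc j) (sym (nCk+nC[k+1]≡[n+1]C[k+1] j 1)) ⟩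
  2 * (j C 1 + j C 2) + suc j   ≡⟨ cong (λ x → 2 * (x + j C 2) + suc j) (nC1≡n j) ⟩
  2 * (j + j C 2) + suc j       ≡⟨ id₁ j (j C 2) ⟩
  2 * (j C 2) + j + (2 * j + 1) ≡⟨ cong (_+ (2 * j + 1)) (double-choose j) ⟩
  j * j + (2 * j + 1)           ≡⟨ id₂ j ⟩
  suc j * suc j                 ∎
  where
  open ≡-Reasoning
  id₁ : ∀ j c → 2 * (j + c) + suc j ≡ 2 * c + j + (2 * j + 1)
  id₁ = solve-∀
  id₂ : ∀ j → j * j + (2 * j + 1) ≡ suc j * suc j
  id₂ = solve-∀

-- Doubling makes the handshake identity applicable, and the added `j` completes the degree sum of
-- the clique to j².
edges-join : ∀ {m} j (H : Graph m) → edges (K j ∏ H) ≡ j C 2 + j * m + edges H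
edges-join {m} j H = double-cancel-≡ (+-cancelʳ-≡ j _ _ (begin
  edges (K j ∏ H) + edges (K j ∏ H) + j
    ≡⟨ cong (_+ j) (trans (handshake (K j ∏ H)) (Σ-++ j m (λ x → Σᶠ (j + m) (λ y → ⟦ adj (K j ∏ H) x y ⟧)))) ⟩
  Σᶠ j (λ x → row (x ↑ˡ m)) + Σᶠ m (λ y → row (j ↑ʳ y)) + j
    ≡⟨ cong₂ (λ a b → a + b + j) (Σ-cong j rowˡ) (Σ-cong m rowʳ) ⟩
  Σᶠ j (λ x → count (adj (K j) x) + m) + Σᶠ m (λ y → j + count (adj H y)) + j
    ≡⟨ cong₂ (λ a b → a + b + j) (trans (Σ-+ j _ _) (cong (adjSum (K j) +_) (Σ-const j m)))
         (trans (Σ-+ m _ _) (cong (_+ adjSum H) (Σ-const m j))) ⟩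
  adjSum (K j) + j * m + (m * j + adjSum H) + j
    ≡⟨ id₁ (adjSum (K j)) (j * m) (m * j) (adjSum H) j ⟩
  (adjSum (K j) + j) + (j * m + m * j) + adjSum H
    ≡⟨ cong₂ (λ a b → a + (j * m + m * j) + b) (trans K-sum (sym (double-choose j))) (sym (handshake H)) ⟩
  (2 * (j C 2) + j) + (j * m + m * j) + (edges H + edges H)
    ≡⟨ id₂ (j C 2) j m (edges H) ⟩
  (j C 2 + j * m + edges H) + (j C 2 + j * m + edges H) + j ∎))
  where
  open ≡-Reasoning
  row : Fin (j + m) → ℕ
  row x = Σᶠ (j + m) (λ y → ⟦ adj (K j ∏ H) x y ⟧)
  rowˡ : ∀ x → row (x ↑ˡ m) ≡ count (adj (K j) x) + m
  rowˡ x = trans (Σ-++ j m _) (cong₂ _+_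
    (Σ-cong j (λ y → cong₂ (λ s t → ⟦ Defs.combine (adj (K j)) (adj H) true s t ⟧)
      (splitAt-↑ˡ j x m) (splitAt-↑ˡ j y m)))
    (trans (Σ-cong m (λ y → cong₂ (λ s t → ⟦ Defs.combine (adj (K j)) (adj H) true s t ⟧)
      (splitAt-↑ˡ j x m) (splitAt-↑ʳ j m y))) (trans (Σ-const m 1) (*-identityʳ m))))
  rowʳ : ∀ y → row (j ↑ʳ y) ≡ j + count (adj H y)
  rowʳ x = trans (Σ-++ j m _) (cong₂ _+_
    (trans (Σ-cong j (λ y → cong₂ (λ s t → ⟦ Defs.combine (adj (K j)) (adj H) true s t ⟧)
      (splitAt-↑ʳ j m x) (splitAt-↑ˡ j y m))) (trans (Σ-const j 1) (*-identityʳ j)))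
    (Σ-cong m (λ y → cong₂ (λ s t → ⟦ Defs.combine (adj (K j)) (adj H) true s t ⟧)
      (splitAt-↑ʳ j m x) (splitAt-↑ʳ j m y))))
  K-row : ∀ x → count (adj (K j) x) + 1 ≡ j
  K-row x = trans (cong (count (adj (K j) x) +_)
      (sym (trans (Σ-cong j (λ y → trans (yes-δ x y) (sym (*-identityʳ _)))) (Σ-δ x (λ _ → 1)))))
    (trans (+-comm _ (count (λ y → isYes (x ≟ y)))) (count-not (λ y → isYes (x ≟ y))))
    where
    yes-δ : ∀ x y → ⟦ isYes (x ≟ y) ⟧ ≡ δ x y
    yes-δ x y with x ≟ y
    ... | yes _ = refl
    ... | no _  = refl
  K-sum : adjSum (K j) + j ≡ j * j
  K-sum = trans (cong (adjSum (K j) +_) (sym (trans (Σ-const j 1) (*-identityʳ j))))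
    (trans (sym (Σ-+ j _ _)) (trans (Σ-cong j K-row) (Σ-const j j)))
  id₁ : ∀ a b c d j → a + b + (c + d) + j ≡ (a + j) + (b + c) + d
  id₁ = solve-∀
  id₂ : ∀ c j m e → (2 * c + j) + (j * m + m * j) + (e + e) ≡ (c + j * m + e) + (c + j * m + e) + j
  id₂ = solve-∀

-- Turán graphs

colourable-⊆ : ∀ {k n r} (F : Graph k) (G : Graph n) → F ⊆ G → Colourable G r → Colourable F r
colourable-⊆ F G (f , _ , hom) (col , proper) = col ∘ f , λ i j ij → proper (f i) (f j) (hom i j ij)

module _ (p : ℕ) where
  private
    r : ℕ
    r = suc p

  turán : ∀ n → Graph n
  turán n = record
    { adj    = λ i j → not (does (residue i ≟ residue j))
    ; adjSym = λ i j → cong not (does-⇔ (mk⇔ sym sym) (residue i ≟ residue j) (residue j ≟ residue i))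
    ; irrefl = λ i → cong not (dec-true (residue i ≟ residue i) refl) }
    where
    residue : Fin n → Fin r
    residue i = toℕ i mod r

  turán-colourable : ∀ n → Colourable (turán n) r
  turán-colourable n = (λ i → toℕ i mod r) ,
    λ i j ij → does-false ((toℕ i mod r) ≟ (toℕ j mod r)) (not-true ij)

  -- Members of one residue class are determined by their quotients by `r`, of which there are at
  -- most n/r + 1.
  residue-class-≤ : ∀ n (c : Fin r) → r * count {n} (λ j → does (c ≟ (toℕ j mod r))) ≤ n + r
  residue-class-≤ n c = begin
    r * count Class            ≤⟨ *-monoʳ-≤ r (injective⇒≤ {f = quot} quot-inj) ⟩
    r * suc (n / r)         ≡⟨ trans (*-suc r (n / r)) (+-comm r _) ⟩
    r * (n / r) + r         ≤⟨ +-monoˡ-≤ r (≤-trans (≤-reflexive (*-comm r (n / r))) (m/n*n≤m n r)) ⟩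
    n + r                   ∎
    where
    open ≤-Reasoning
    Class : Fin n → Bool
    Class j = does (c ≟ (toℕ j mod r))
    bound : ∀ a → toℕ (enum Class a) / r < suc (n / r)
    bound a = s≤s (/-monoˡ-≤ r (<⇒≤ (toℕ<n (enum Class a))))
    quot : Fin (count Class) → Fin (suc (n / r))
    quot a = fromℕ< (bound a)
    rem : ∀ a → toℕ c ≡ toℕ (enum Class a) % r
    rem a = trans (cong toℕ (does-true (c ≟ (toℕ (enum Class a) mod r)) (enum-∈ Class a))) (toℕ-fromℕ< _)
    quot-inj : Injective′ quot
    quot-inj {a} {b} eq = enum-injective Class (toℕ-injective (trans (m≡m%n+[m/n]*n _ r)
      (trans (cong₂ (λ x y → x + y * r) (trans (sym (rem a)) (rem b))
        (fromℕ<-injective _ _ (bound a) (bound b) eq))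
      (sym (m≡m%n+[m/n]*n _ r)))))

  turán-dense : ∀ n → TuránDense r (turán n)
  turán-dense n = begin
    r * nonEdgesAll (turán n)         ≡⟨ cong (r *_) (Σ-cong n (λ i → *-identityˡ _)) ⟩
    r * Σᶠ n (nonDegree (turán n))    ≡⟨ sym (Σ-*ˡ n r _) ⟩
    Σᶠ n (λ i → r * nonDegree (turán n) i) ≤⟨ Σ-mono n (λ i → ≤-trans (≤-reflexive (cong (r *_) (class i)))
                                                (residue-class-≤ n (toℕ i mod r))) ⟩
    Σᶠ n (λ _ → n + r)                ≡⟨ trans (Σ-const n (n + r)) (ident n r) ⟩
    n * n + r * n                     ∎
    where
    open ≤-Reasoning
    class : ∀ i → nonDegree (turán n) i ≡ count {n} (λ j → does ((toℕ i mod r) ≟ (toℕ j mod r)))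
    class i = Σ-cong n (λ j → trans (*-identityˡ _) (cong ⟦_⟧ (not-involutive _)))
    ident : ∀ n r → n * (n + r) ≡ n * n + r * n
    ident = solve-∀

  -- The Turán graph is r-colourable and hence F-free, so an extremal graph has at least as many
  -- edges.
  extremal⇒dense : ∀ {k n} {F : Graph k} (G : Graph n) → ¬ Colourable F r → IsEX n F G → TuránDense r G
  extremal⇒dense {n = n} {F} G ¬col (_ , max) = ≤-trans (*-monoʳ-≤ r fewer) (turán-dense n)
    where
    more : edges (turán n) ≤ edges G
    more = max (turán n) (λ sub → ¬col (colourable-⊆ F (turán n) sub (turán-colourable n)))
    fewer : nonEdgesAll G ≤ nonEdgesAll (turán n)
    fewer = +-cancelʳ-≤ (edges G + edges G) _ _ (begin
      nonEdgesAll G + (edges G + edges G)                    ≡⟨ trans (nonEdges+edges G) (sym (nonEdges+edges (turán n))) ⟩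
      nonEdgesAll (turán n) + (edges (turán n) + edges (turán n)) ≤⟨ +-monoʳ-≤ (nonEdgesAll (turán n)) (+-mono-≤ more more) ⟩
      nonEdgesAll (turán n) + (edges G + edges G)            ∎)
      where open ≤-Reasoning

-- Cloning a vertex

addVertex : ∀ {m} → Graph m → (Fin m → Bool) → Graph (suc m)
addVertex {m} H S = record { adj = a ; adjSym = a-sym ; irrefl = a-irr }
  where
  a : Fin (suc m) → Fin (suc m) → Bool
  a zero    zero    = false
  a zero    (suc j) = S j
  a (suc i) zero    = S i
  a (suc i) (suc j) = adj H i j
  a-sym : ∀ i j → a i j ≡ a j i
  a-sym zero    zero    = refl
  a-sym zero    (suc j) = refl
  a-sym (suc i) zero    = refl
  a-sym (suc i) (suc j) = adjSym H i j
  a-irr : ∀ i → a i i ≡ false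
  a-irr zero    = refl
  a-irr (suc i) = irrefl H i

edges-addVertex : ∀ {m} (H : Graph m) S → edges (addVertex H S) ≡ count S + edges H
edges-addVertex {m} H S = cong (_+ edges H) (Σ-cong m (λ j → indicator (S j)))

lower : ∀ {m} → Fin m → Fin (suc m) → Fin m
lower d zero    = d
lower d (suc x) = x

-- A copy of F through the new vertex can be rerouted through a vertex of the block it does not use.
module _ {k m} {F : Graph k} (H : Graph m) (S : Fin m → Bool) (block : Fin k → Fin m)
         (block-inj : Injective′ block) (joined : ∀ c v → S v ≡ true → adj H (block c) v ≡ true) where

  private
    reroute : (f : Fin k → Fin (suc m)) → Injective′ f →
      (∀ i j → adj F i j ≡ true → adj (addVertex H S) (f i) (f j) ≡ true) →
      ∀ c → (∀ i j → f i ≡ zero → f j ≢ suc (block c)) → F ⊆ H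
    reroute f inj hom c unused = g , g-inj , g-hom
      where
      g : Fin k → Fin m
      g i = lower (block c) (f i)
      g-inj : Injective′ g
      g-inj {i} {j} eq with f i in fi | f j in fj
      ... | zero  | zero  = inj (trans fi (sym fj))
      ... | zero  | suc y = ⊥-elim (unused i j fi (trans fj (cong suc (sym eq))))
      ... | suc x | zero  = ⊥-elim (unused j i fj (trans fi (cong suc eq)))
      ... | suc x | suc y = inj (trans fi (trans (cong suc eq) (sym fj)))
      g-hom : ∀ i j → adj F i j ≡ true → adj H (g i) (g j) ≡ true
      g-hom i j ij with f i | f j | hom i j ij
      ... | zero  | suc y | h = joined c y h
      ... | suc x | zero  | h = trans (adjSym H _ _) (joined c x h)
      ... | suc x | suc y | h = h

  clone-free : Fin k → Free F H → Free F (addVertex H S)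
  clone-free u free (f , inj , hom) with any? (λ i → f i ≟ zero)
  -- The copy already lies in `H`, so any block index will do, and `u` supplies one.
  ... | no none = free (reroute f inj hom u (λ i _ eq → ⊥-elim (none (i , eq))))
  ... | yes (i₀ , fi₀) with any? (λ c → img f (suc (block c)) ≟ᵇ false)
  ...   | yes (c , unused) = free (reroute f inj hom c (λ _ j _ → img-∉ f _ unused j))
  -- A copy using the new vertex and the whole block would have more than `k` vertices.
  ...   | no none = <-irrefl refl (begin-strict
    count (img f ∘ suc)          <⟨ ≤-refl ⟩
    1 + count (img f ∘ suc)      ≡⟨ cong (λ b → ⟦ b ⟧ + count (img f ∘ suc))
                                      (sym (subst (λ x → img f x ≡ true) fi₀ (img-∈ f i₀))) ⟩
    count (img f)                ≡⟨ count-img f inj ⟩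
    k                            ≤⟨ count-injective block block-inj (img f ∘ suc) used ⟩
    count (img f ∘ suc)          ∎)
    where
    open ≤-Reasoning
    used : ∀ c → img f (suc (block c)) ≡ true
    used c with bool? (img f (suc (block c)))
    ... | inj₁ t = t
    ... | inj₂ t = ⊥-elim (none (c , t))

-- Heavy vertices: at most (1 - 1/(q + 1))n/r non-neighbours, where r = p + 1

heavyBound : ℕ → ℕ → ℕ → ℕ
heavyBound p q n = (q * n) / (suc q * suc p)

module _ (p q n : ℕ) where
  private
    a₀ : ℕ
    a₀ = heavyBound p q n

  heavyBound-heavy : ∀ {d} → d ≤ a₀ → suc q * (suc p * d) ≤ q * n
  heavyBound-heavy {d} d≤ = begin
    suc q * (suc p * d)       ≡⟨ trans (sym (*-assoc (suc q) (suc p) d)) (*-comm (suc q * suc p) d) ⟩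
    d * (suc q * suc p)       ≤⟨ *-monoˡ-≤ _ d≤ ⟩
    a₀ * (suc q * suc p)      ≤⟨ m/n*n≤m (q * n) (suc q * suc p) ⟩
    q * n                     ∎
    where open ≤-Reasoning

  heavyBound-light : ∀ {d} → ¬ d ≤ a₀ → q * n ≤ suc q * (suc p * d)
  heavyBound-light {d} d≰ = begin
    q * n                                             ≡⟨ m≡m%n+[m/n]*n (q * n) (suc q * suc p) ⟩
    (q * n) % (suc q * suc p) + a₀ * (suc q * suc p)  ≤⟨ +-monoˡ-≤ _ (<⇒≤ (m%n<n (q * n) (suc q * suc p))) ⟩
    suc a₀ * (suc q * suc p)                          ≤⟨ *-monoˡ-≤ _ (≰⇒> d≰) ⟩
    d * (suc q * suc p)                               ≡⟨ trans (*-comm d _) (*-assoc (suc q) (suc p) d) ⟩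
    suc q * (suc p * d)                               ∎
    where open ≤-Reasoning

  heavyBound-≤ : a₀ ≤ n
  heavyBound-≤ = *-cancelˡ-≤ (suc q) (≤-trans (*-monoʳ-≤ (suc q) (m≤m+n a₀ (p * a₀)))
    (≤-trans (heavyBound-heavy ≤-refl) (*-monoˡ-≤ n (n≤1+n q))))

-- All `c` vertices share one cut-off that at most c ≤ h vertices undercut, so a single threshold
-- depending on `h` suffices.
heavyVertices : ∀ p q₀ h t {n} (G : Graph n) → heavyThreshold p q₀ h t ≤ n → TuránDense (suc p) G →
  ∀ c → c ≤ h →
  c ≤ count (λ u → does (nonDegree G u ≤? heavyBound p q₀ n)) →
  Σ (Fin c → Fin n) λ w → Injective′ w ×
    (∀ i → nonDegree G (w i) ≤ heavyBound p q₀ n × Multipartite G (adj G (w i)) (suc p) t)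
heavyVertices p q₀ h t {n} G large turán c c≤h many
  with threshold (nonDegree G) c (heavyBound p q₀ n) many
... | a , a≤ , many′ , few with choose (λ u → does (nonDegree G u ≤? a)) many′
... | w , w-inj , w∈ = w , w-inj , λ i →
  let d≤a = does-true (nonDegree G (w i) ≤? a) (w∈ i) in
  ≤-trans d≤a a≤ ,
  heavyMultipartite p q₀ h t G a (w i) large turán (≤-trans few c≤h) (≤-trans a≤ (heavyBound-≤ p q₀ n)) d≤a
    (heavyBound-heavy p q₀ n (≤-trans d≤a a≤))

-- Extremal numbers grow by almost (1 − 1/r)m

¬apexNbhd : ∀ {k m r} {F : Graph k} → Apex F r → (H : Graph m) → Free F H →
  ∀ v → ¬ Multipartite H (adj H v) r k
¬apexNbhd A H free v M = free (proj₁ (apex-embed A H v (λ _ x∈ → x∈) M))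

module _ {k} {F : Graph k} {p} (A : Apex F (suc p)) (q₃′ T : ℕ)
         (4r≤q₃ : 4 * suc p ≤ suc q₃′) where

  private
    r q₃ q₂ q M : ℕ
    r  = suc p
    q₃ = suc q₃′
    q₂ = 8 * (r * q₃)
    q  = p + 3 * suc p
    M  = proj₁ (erdősStone-minDegree p q r T ≤-refl)

  balancedThreshold : ℕ
  -- `suc q₂ * r` makes the rounding term of `TuránDense` small, and `2 * M` makes `High`, at least
  -- half of the vertices, large enough for Erdős-Stone.
  balancedThreshold = heavyThreshold p q₂ 1 k + (suc q₂ * r + 2 * M)

  module _ {m} (H : Graph m) (large : balancedThreshold ≤ m) (free : Free F H)
           (turán : TuránDense (suc p) H) where

    private
      d : Fin m → ℕ
      d = nonDegree H

      -- A vertex with fewer non-neighbours would be the apex of a copy of `F`.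
      light : ∀ v → q₂ * m ≤ suc q₂ * (r * d v)
      light v = heavyBound-light p q₂ m λ d≤ →
        let w , _ , heavy = heavyVertices p q₂ 1 k H (≤-trans (m≤m+n (heavyThreshold p q₂ 1 k) _) large) turán 1 ≤-refl
              (≤-trans (≤-reflexive (cong ⟦_⟧ (sym (dec-true (d v ≤? heavyBound p q₂ m) d≤))))
                (Σ-member m (λ u → ⟦ does (d u ≤? heavyBound p q₂ m) ⟧) v))
        in ¬apexNbhd A H free (w zero) (proj₂ (heavy zero))

      -- Low refers to the degree: these vertices have more than (1 + 1/q₃)m/r non-neighbours.
      low : Fin m → Bool
      low v = does (suc q₃ * m <? q₃ * (r * d v))

      L : ℕ
      L = count low

      large′ : suc q₂ * r + 2 * M ≤ m
      large′ = ≤-trans (m≤n+m _ (heavyThreshold p q₂ 1 k)) large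

      instance
        m≢0 : NonZero m
        m≢0 = >-nonZero (≤-trans (s≤s z≤n) large′)

      low-pointwise : ∀ v → q₃ * (q₂ * m) + ⟦ low v ⟧ * ((suc q₂ + q₃) * m) ≤ suc q₂ * (q₃ * (r * d v))
      low-pointwise v = go (low v) refl
        where
        ident : ∀ q₃ q₂ m → q₃ * (q₂ * m) + 1 * ((suc q₂ + q₃) * m) ≡ suc q₂ * (suc q₃ * m)
        ident = solve-∀
        swap : ∀ x y z → x * (y * z) + 0 ≡ y * (x * z)
        swap = solve-∀
        go : ∀ b → low v ≡ b → q₃ * (q₂ * m) + ⟦ b ⟧ * ((suc q₂ + q₃) * m) ≤ suc q₂ * (q₃ * (r * d v))
        go true  eq = ≤-trans (≤-reflexive (ident q₃ q₂ m))
          (*-monoʳ-≤ (suc q₂) (<⇒≤ (does-true (suc q₃ * m <? q₃ * (r * d v)) eq)))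
        go false eq = ≤-trans (+-monoˡ-≤ 0 (*-monoʳ-≤ q₃ (light v)))
          (≤-reflexive (swap q₃ (suc q₂) (r * d v)))

      -- Markov's inequality: the average number of non-neighbours is at most m/r + 1 and by `light`
      -- none is much below m/r, so few can be much above. The value 8rq₃ of `q₂` then gives the
      -- bound m/(4r) in `low-few`.
      low-sum : q₃ * q₂ * m + L * (suc q₂ + q₃) ≤ suc q₂ * q₃ * (m + r)
      low-sum = *-cancelʳ-≤ _ _ m (begin
        (q₃ * q₂ * m + L * (suc q₂ + q₃)) * m
          ≡⟨ id₁ q₃ q₂ m L ⟩
        m * (q₃ * (q₂ * m)) + L * ((suc q₂ + q₃) * m)
          ≡⟨ cong₂ _+_ (sym (Σ-const m _)) (sym (Σ-*ʳ m ((suc q₂ + q₃) * m) (⟦_⟧ ∘ low))) ⟩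
        Σᶠ m (λ _ → q₃ * (q₂ * m)) + Σᶠ m (λ v → ⟦ low v ⟧ * ((suc q₂ + q₃) * m))
          ≡⟨ sym (Σ-+ m _ _) ⟩
        Σᶠ m (λ v → q₃ * (q₂ * m) + ⟦ low v ⟧ * ((suc q₂ + q₃) * m))
          ≤⟨ Σ-mono m low-pointwise ⟩
        Σᶠ m (λ v → suc q₂ * (q₃ * (r * d v)))
          ≡⟨ trans (Σ-*ˡ m (suc q₂) _) (cong (suc q₂ *_) (trans (Σ-*ˡ m q₃ _) (cong (q₃ *_) (Σ-*ˡ m r d)))) ⟩
        suc q₂ * (q₃ * (r * Σᶠ m d))
          ≡⟨ cong (λ x → suc q₂ * (q₃ * (r * x))) (Σ-cong m (λ v → sym (*-identityˡ (d v)))) ⟩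
        suc q₂ * (q₃ * (r * nonEdgesAll H))
          ≤⟨ *-monoʳ-≤ (suc q₂) (*-monoʳ-≤ q₃ turán) ⟩
        suc q₂ * (q₃ * (m * m + r * m))
          ≡⟨ id₂ (suc q₂) q₃ m r ⟩
        suc q₂ * q₃ * (m + r) * m ∎)
        where
        open ≤-Reasoning
        id₁ : ∀ a b m L → (a * b * m + L * (suc b + a)) * m ≡ m * (a * (b * m)) + L * ((suc b + a) * m)
        id₁ = solve-∀
        id₂ : ∀ a b m r → a * (b * (m * m + r * m)) ≡ a * b * (m + r) * m
        id₂ = solve-∀

      low-few : 4 * (r * L) ≤ m
      low-few = *-cancelˡ-≤ (2 * q₃) (≤-from _ _ (L * suc q₃)
        (+-mono-≤ low-sum (*-monoʳ-≤ q₃ (≤-trans (m≤m+n (suc q₂ * r) (2 * M)) large′)))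
        (ident q₃ r L m))
        where
        ident : ∀ a r L m →
          2 * a * (4 * (r * L)) + (suc (8 * (r * a)) * a * (m + r) + a * m) + L * suc a
          ≡ 2 * a * m + (a * (8 * (r * a)) * m + L * (suc (8 * (r * a)) + a) + a * (suc (8 * (r * a)) * r))
        ident = solve-∀

    High : Fin m → Bool
    High v = not (low v)

    private
      high-bound : ∀ v → High v ≡ true → q₃ * (r * d v) ≤ suc q₃ * m
      high-bound v v∈ = ≮⇒≥ (does-false (suc q₃ * m <? q₃ * (r * d v)) (not-true v∈))

      split : m ≡ count High + L
      split = sym (trans (+-comm (count High) L) (count-not low))

      -- With q + 1 = 4r, the left side is at most 4p(1 + 1/q₃)m ≤ (4p + 1)m, while |High| ≥ (1 -
      -- 1/(4r))m makes the right side at least (4p + 2)m.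
      high-dense : Dense p q H High
      high-dense v v∈ = *-cancelˡ-≤ q₃ (begin
        q₃ * (suc q * (p * nonDeg H High v))   ≤⟨ *-monoʳ-≤ q₃ (*-monoʳ-≤ (suc q) (*-monoʳ-≤ p nd≤d)) ⟩
        q₃ * (suc q * (p * d v))               ≡⟨ id₁ q₃ p (d v) ⟩
        4 * p * (q₃ * (r * d v))               ≤⟨ *-monoʳ-≤ (4 * p) (high-bound v v∈) ⟩
        4 * p * (suc q₃ * m)                   ≤⟨ ≤-from _ _ (q₃ * count High + 2 * (q₃ * L))
                                                   (+-mono-≤ (*-monoʳ-≤ q₃ low-few) (*-monoˡ-≤ m 4p≤q₃))
                                                   (id₂ p q₃ {count High} {L} split) ⟩
        q₃ * (q * count High)                  ∎)
        where
        open ≤-Reasoning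
        nd≤d : nonDeg H High v ≤ d v
        nd≤d = Σ-mono m (λ j → *-monoˡ-≤ (na H v j) (⟦⟧≤1 (High j)))
        4p≤q₃ : 4 * p ≤ q₃
        4p≤q₃ = ≤-trans (*-monoʳ-≤ 4 (n≤1+n p)) 4r≤q₃
        id₁ : ∀ a p d → a * (suc (p + 3 * suc p) * (p * d)) ≡ 4 * p * (a * (suc p * d))
        id₁ = solve-∀
        id₂′ : ∀ p a k L → 4 * p * (suc a * (k + L)) + (a * (k + L) + a * (k + L)) + (a * k + 2 * (a * L))
          ≡ a * ((p + 3 * suc p) * k) + (a * (4 * (suc p * L)) + 4 * p * (k + L))
        id₂′ = solve-∀
        id₂ : ∀ p a {k L m} → m ≡ k + L → 4 * p * (suc a * m) + (a * m + a * m) + (a * k + 2 * (a * L))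
          ≡ a * ((p + 3 * suc p) * k) + (a * (4 * (suc p * L)) + 4 * p * m)
        id₂ p a refl = id₂′ p a _ _

      high-large : M ≤ count High
      high-large = *-cancelˡ-≤ 2 (≤-trans (≤-trans (m≤n+m _ (suc q₂ * r)) large′) (
        ≤-from m (2 * count High) (2 * L + 4 * (p * L)) low-few (ident {count High} {L} {p} split)))
        where
        ident′ : ∀ k L p → (k + L) + (k + L) + (2 * L + 4 * (p * L)) ≡ 2 * k + 4 * (suc p * L)
        ident′ = solve-∀
        ident : ∀ {k L p m} → m ≡ k + L → m + m + (2 * L + 4 * (p * L)) ≡ 2 * k + 4 * (suc p * L)
        ident {k} {L} {p} refl = ident′ k L p

    balancedMultipartite : Multipartite H High r T
    balancedMultipartite = proj₂ (erdősStone-minDegree p q r T ≤-refl) H High high-dense high-large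

    balancedMultipartite-nonDegree : ∀ i a →
      q₃ * (r * nonDegree H (part balancedMultipartite i a)) ≤ suc q₃ * m
    balancedMultipartite-nonDegree i a = high-bound _ (inside balancedMultipartite i a)

module _ {k} {F : Graph k} {p} (A : Apex F (suc p)) (q₁ q₃′ : ℕ)
         (2kq₁≤q₃ : 2 * (k * q₁) ≤ suc q₃′) {m} (H : Graph m) (free : Free F H) {S₀ : Fin m → Bool}
         (multi : Multipartite H S₀ (suc p) (suc q₃′ * k))
         (balanced : ∀ i a → suc q₃′ * (suc p * nonDegree H (part multi i a)) ≤ suc (suc q₃′) * m) where

  private
    r q₃ T : ℕ
    r  = suc p
    q₃ = suc q₃′
    T  = q₃ * k

    everywhere : Multipartite H (λ _ → true) r T
    everywhere = widen (λ _ _ → refl) multi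

    nd : Fin r → Fin m → ℕ
    nd = partNonDeg H (λ _ → true) everywhere

    -- Otherwise v would be the apex of a copy of F.
    poorPart : ∀ v → ∃ λ i → T ≤ nd i v + k
    poorPart v =
      let i , ¬le = ¬∀⟶∃¬ r _ (λ i → k ≤? nbrs i) none in
      i , ≤-trans (≤-reflexive (sym (partNbrs H _ everywhere i v)))
            (≤-trans (+-monoˡ-≤ (nd i v) (<⇒≤ (≰⇒> ¬le))) (≤-reflexive (+-comm k (nd i v))))
      where
      nbrs : Fin r → ℕ
      nbrs i = count (λ a → adj H (part multi i a) v)
      none : ¬ (∀ i → k ≤ nbrs i)
      none all = ¬apexNbhd A H free v (record
        { part   = λ i a → part multi i (proj₁ (sub i) a)
        ; inside = λ i a → trans (adjSym H v _) (proj₂ (proj₂ (sub i)) a)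
        ; part-injective = λ i eq → proj₁ (proj₂ (sub i)) (part-injective multi i eq)
        ; cross  = λ ne a b → cross multi ne _ _ })
        where
        sub : ∀ i → Σ (Fin k → Fin T) λ f → Injective′ f × (∀ a → adj H (part multi i (f a)) v ≡ true)
        sub i = choose (λ a → adj H (part multi i a) v) (all i)

    -- Each part is cut into `q₃` blocks of `k` vertices; one of them becomes the block of
    -- `clone-free`.
    vertex : Fin r → Fin q₃ → Fin k → Fin m
    vertex i b c = part multi i (combine b c)

    missed? : ∀ i b v → Dec (∃ λ c → adj H (vertex i b c) v ≡ false)
    missed? i b v = any? (λ c → adj H (vertex i b c) v ≟ᵇ false)

    missed : Fin r → Fin q₃ → Fin m → ℕ
    missed i b v = ⟦ does (missed? i b v) ⟧

    missed-≤ : ∀ i b v → missed i b v ≤ Σᶠ k (λ c → na H (vertex i b c) v)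
    missed-≤ i b v with missed? i b v
    ... | no _          = z≤n
    ... | yes (c , out) = ≤-trans (≤-reflexive (cong (⟦_⟧ ∘ not) (sym out)))
                            (Σ-member k (λ c → na H (vertex i b c) v) c)

    -- In every part, each missed block contains a non-neighbour of `v`. In the poor part the blocks
    -- contribute at most `q₃`, although `v` has at least T - k non-neighbours there; this
    -- difference is the overlap that bounds the union of the missed sets.
    missed-sum : ∀ v → Σᶠ r (λ i → Σᶠ q₃ (λ b → missed i b v)) + T ≤ Σᶠ r (λ i → nd i v) + (q₃ + k)
    missed-sum v = let i , poor = poorPart v in
      Σ-mono-extra r i perPart (begin
        Σᶠ q₃ (λ b → missed i b v) + T   ≤⟨ +-mono-≤ (Σ-mono q₃ (λ b → ⟦⟧≤1 (does (missed? i b v)))) poor ⟩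
        Σᶠ q₃ (λ _ → 1) + (nd i v + k)   ≡⟨ cong (_+ (nd i v + k)) (trans (Σ-const q₃ 1) (*-identityʳ q₃)) ⟩
        q₃ + (nd i v + k)                ≡⟨ ident q₃ (nd i v) k ⟩
        nd i v + (q₃ + k)                ∎)
      where
      open ≤-Reasoning
      ident : ∀ a b c → a + (b + c) ≡ b + (a + c)
      ident = solve-∀
      perPart : ∀ i → Σᶠ q₃ (λ b → missed i b v) ≤ nd i v
      perPart i = ≤-trans (Σ-mono q₃ (λ b → missed-≤ i b v))
        (≤-reflexive (sym (Σ-combine q₃ k (λ a → na H (part multi i a) v))))

    total-≤ : totalNonDeg H (λ _ → true) everywhere ≤ k * (suc q₃ * m)
    total-≤ = *-cancelˡ-≤ q₃ (begin
      q₃ * totalNonDeg H (λ _ → true) everywhere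
        ≡⟨ sym (trans (Σ-cong r (λ i → Σ-*ˡ T q₃ (d i))) (Σ-*ˡ r q₃ (λ i → Σᶠ T (d i)))) ⟩
      Σᶠ r (λ i → Σᶠ T (λ a → q₃ * nonDegree H (part multi i a)))
        ≤⟨ Σ-parts-≤ r T (λ i a → q₃ * nonDegree H (part multi i a)) (λ i a →
             ≤-trans (≤-reflexive (swap r q₃ _)) (balanced i a)) ⟩
      T * (suc q₃ * m)
        ≡⟨ *-assoc q₃ k _ ⟩
      q₃ * (k * (suc q₃ * m)) ∎)
      where
      open ≤-Reasoning
      d : Fin r → Fin T → ℕ
      d i a = nonDegree H (part multi i a)
      swap : ∀ x y z → x * (y * z) ≡ y * (x * z)
      swap = solve-∀

    blockSum : ℕ
    blockSum = Σᶠ r (λ i → Σᶠ q₃ (λ b → Σᶠ m (missed i b)))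

    -- Summed over all vertices, `T` in `missed-sum` contributes kq₃m, almost the whole total k(q₃ +
    -- 1)m. Averaging over rq₃ blocks then leaves (1 + 2k/q₃)m/r per block, which is at most (1 +
    -- 1/q₁)m/r.
    blockSum-≤ : blockSum ≤ m * (q₃ + 2 * k)
    blockSum-≤ = ≤-from _ _ 0 (begin
      blockSum + m * T
        ≡⟨ cong₂ _+_ reorder (sym (Σ-const m T)) ⟩
      Σᶠ m (λ v → Σᶠ r (λ i → Σᶠ q₃ (λ b → missed i b v))) + Σᶠ m (λ _ → T)
        ≡⟨ sym (Σ-+ m _ _) ⟩
      Σᶠ m (λ v → Σᶠ r (λ i → Σᶠ q₃ (λ b → missed i b v)) + T)
        ≤⟨ Σ-mono m missed-sum ⟩
      Σᶠ m (λ v → Σᶠ r (λ i → nd i v) + (q₃ + k))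
        ≡⟨ trans (Σ-+ m _ _) (cong₂ _+_ swapped (Σ-const m (q₃ + k))) ⟩
      totalNonDeg H (λ _ → true) everywhere + m * (q₃ + k)
        ≤⟨ +-monoˡ-≤ (m * (q₃ + k)) total-≤ ⟩
      k * (suc q₃ * m) + m * (q₃ + k) ∎)
      (ident blockSum m q₃ k)
      where
      open ≤-Reasoning
      reorder : blockSum ≡ Σᶠ m (λ v → Σᶠ r (λ i → Σᶠ q₃ (λ b → missed i b v)))
      reorder = trans (Σ-cong r (λ i → Σ-swap q₃ m (missed i))) (Σ-swap r m (λ i v → Σᶠ q₃ (λ b → missed i b v)))
      swapped : Σᶠ m (λ v → Σᶠ r (λ i → nd i v)) ≡ totalNonDeg H (λ _ → true) everywhere
      swapped = trans (Σ-cong m (λ v → sym (*-identityˡ (Σᶠ r (λ i → nd i v)))))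
        (sym (totalNonDeg-swap H (λ _ → true) everywhere))
      ident : ∀ x m a k → x + (k * (suc a * m) + m * (a + k)) + 0 ≡ m * (a + 2 * k) + (x + m * (a * k))
      ident = solve-∀

    bestBlock : ∃ λ i → ∃ λ b → r * (q₁ * Σᶠ m (missed i b)) ≤ suc q₁ * m
    bestBlock =
      let i , le  = Σ-average p (λ i → Σᶠ q₃ (λ b → Σᶠ m (missed i b)))
          b , le′ = Σ-average q₃′ (λ b → Σᶠ m (missed i b))
      in i , b , bound (Σᶠ m (missed i b)) (≤-trans (*-monoʳ-≤ r le′) (≤-trans le blockSum-≤))
      where
      bound : ∀ y → r * (q₃ * y) ≤ m * (q₃ + 2 * k) → r * (q₁ * y) ≤ suc q₁ * m
      bound y le = *-cancelˡ-≤ q₃ (begin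
        q₃ * (r * (q₁ * y))                    ≡⟨ id₁ q₃ r q₁ y ⟩
        q₁ * (r * (q₃ * y))                    ≤⟨ *-monoʳ-≤ q₁ le ⟩
        q₁ * (m * (q₃ + 2 * k))                ≡⟨ id₂ q₁ m q₃ k ⟩
        m * (q₁ * q₃ + 2 * (k * q₁))           ≤⟨ *-monoʳ-≤ m (+-monoʳ-≤ (q₁ * q₃) 2kq₁≤q₃) ⟩
        m * (q₁ * q₃ + q₃)                     ≡⟨ id₃ m q₁ q₃ ⟩
        q₃ * (suc q₁ * m)                      ∎)
        where
        open ≤-Reasoning
        id₁ : ∀ a r q y → a * (r * (q * y)) ≡ q * (r * (a * y))
        id₁ = solve-∀
        id₂ : ∀ q m a k → q * (m * (a + 2 * k)) ≡ m * (q * a + 2 * (k * q))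
        id₂ = solve-∀
        id₃ : ∀ m q a → m * (q * a + a) ≡ a * (suc q * m)
        id₃ = solve-∀

  extend : Σ (Graph (suc m)) λ H′ → Free F H′ ×
    (r * q₁ * (edges H + m) ≤ r * q₁ * edges H′ + suc q₁ * m)
  extend = addVertex H S , clone-free {F = F} H S (vertex i b) inj joined (apex A) free , (begin
    r * q₁ * (edges H + m)                      ≡⟨ cong (λ x → r * q₁ * (edges H + x)) (sym size) ⟩
    r * q₁ * (edges H + (count S + y))          ≡⟨ ident r q₁ (edges H) (count S) y ⟩
    r * q₁ * (count S + edges H) + r * (q₁ * y) ≤⟨ +-mono-≤ (≤-reflexive (cong (r * q₁ *_) (sym (edges-addVertex H S)))) y≤ ⟩
    r * q₁ * edges (addVertex H S) + suc q₁ * m ∎)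
    where
    open ≤-Reasoning
    i : Fin r
    i = proj₁ bestBlock
    b : Fin q₃
    b = proj₁ (proj₂ bestBlock)
    y : ℕ
    y = Σᶠ m (missed i b)
    y≤ : r * (q₁ * y) ≤ suc q₁ * m
    y≤ = proj₂ (proj₂ bestBlock)
    S : Fin m → Bool
    S v = not (does (missed? i b v))
    size : count S + y ≡ m
    size = trans (+-comm (count S) y) (count-not (λ v → does (missed? i b v)))
    inj : Injective′ (vertex i b)
    inj {c} {c′} eq = proj₂ (combine-injective b c b c′ (part-injective multi i eq))
    joined : ∀ c v → S v ≡ true → adj H (vertex i b c) v ≡ true
    joined c v v∈ with bool? (adj H (vertex i b c) v)
    ... | inj₁ t = t
    ... | inj₂ t = ⊥-elim (does-false (missed? i b v) (not-true v∈) (c , t))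
    ident : ∀ r q e s y → r * q * (e + (s + y)) ≡ r * q * (s + e) + r * (q * y)
    ident = solve-∀

-- Cleared of denominators, the increment is at least m - (1 + 1/q₁)m/r. The precision `q₁` remains
-- free, because the error has to stay below the gain of one universal vertex over boundedly many
-- steps.
extremal-growth : ∀ {k} {F : Graph k} {p} → Apex F (suc p) → ∀ q₁ → ∃ λ M → ∀ {m} → M ≤ m →
  (H : Graph m) (H′ : Graph (suc m)) → IsEX m F H → IsEX (suc m) F H′ →
  suc p * q₁ * (edges H + m) ≤ suc p * q₁ * edges H′ + suc q₁ * m
extremal-growth {k} {F} {p} A q₁ = balancedThreshold A q₃′ T 4r≤q₃ , λ {m} large H H′ ex ex′ →
  let multi = balancedMultipartite A q₃′ T 4r≤q₃ H large (proj₁ ex) (dense H ex)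
      bal   = balancedMultipartite-nonDegree A q₃′ T 4r≤q₃ H large (proj₁ ex) (dense H ex)
      H⁺ , free , more = extend A q₁ q₃′ 2kq₁≤q₃ H (proj₁ ex) multi bal
  in ≤-trans more (+-monoˡ-≤ (suc q₁ * m) (*-monoʳ-≤ (suc p * q₁) (proj₂ ex′ H⁺ free)))
  where
  -- `q₃` is at least 4r for `high-dense` and at least 2kq₁ for `bestBlock`.
  q₃′ T : ℕ
  q₃′ = 4 * suc p + 2 * (k * q₁)
  T   = suc q₃′ * k
  4r≤q₃ : 4 * suc p ≤ suc q₃′
  4r≤q₃ = ≤-trans (m≤m+n (4 * suc p) _) (n≤1+n q₃′)
  2kq₁≤q₃ : 2 * (k * q₁) ≤ suc q₃′
  2kq₁≤q₃ = ≤-trans (m≤n+m _ (4 * suc p)) (n≤1+n q₃′)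
  dense : ∀ {m} (H : Graph m) → IsEX m F H → TuránDense (suc p) H
  dense H = extremal⇒dense p {F = F} H (¬colourable A)

-- Disjoint unions and joins

embed-⊎ : ∀ {k l n} {A : Graph k} {B : Graph l} {G : Graph n} (f : A ⊆ G) (g : B ⊆ G) →
  (∀ a b → proj₁ f a ≢ proj₁ g b) →
  Σ ((A ⊎ᴳ B) ⊆ G) λ e → ∀ x → (∃ λ a → proj₁ e x ≡ proj₁ f a) ⊎ (∃ λ b → proj₁ e x ≡ proj₁ g b)
embed-⊎ {k} {l} {n} {A} {B} {G} (f , f-inj , f-hom) (g , g-inj , g-hom) disjoint =
  (e ∘ splitAt k , e-injective , λ x y → e-hom (splitAt k x) (splitAt k y)) , e-image ∘ splitAt k
  where
  e : Fin k ⊎ Fin l → Fin n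
  e (inj₁ a) = f a
  e (inj₂ b) = g b
  e-inj : ∀ s t → e s ≡ e t → s ≡ t
  e-inj (inj₁ a) (inj₁ a′) eq = cong inj₁ (f-inj eq)
  e-inj (inj₁ a) (inj₂ b)  eq = ⊥-elim (disjoint a b eq)
  e-inj (inj₂ b) (inj₁ a)  eq = ⊥-elim (disjoint a b (sym eq))
  e-inj (inj₂ b) (inj₂ b′) eq = cong inj₂ (g-inj eq)
  e-injective : Injective′ (e ∘ splitAt k)
  e-injective {x} {y} eq = trans (sym (join-splitAt k l x))
    (trans (cong (join k l) (e-inj (splitAt k x) (splitAt k y) eq)) (join-splitAt k l y))
  e-hom : ∀ s t → Defs.combine (adj A) (adj B) false s t ≡ true → adj G (e s) (e t) ≡ true
  e-hom (inj₁ a) (inj₁ a′) = f-hom a a′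
  e-hom (inj₂ b) (inj₂ b′) = g-hom b b′
  e-image : ∀ s → (∃ λ a → e s ≡ f a) ⊎ (∃ λ b → e s ≡ g b)
  e-image (inj₁ a) = inj₁ (a , refl)
  e-image (inj₂ b) = inj₂ (b , refl)

-- Priv j is the set of vertices reserved for F j; all other vertices used must be Common.
greedy-embed : ∀ {n} (G : Graph n) B h v (F : (i : Fin h) → Graph (v i))
  (Priv : Fin h → Fin n → Set) (Common : Fin n → Set) →
  (∀ i j x → Priv i x → Priv j x → i ≡ j) → (∀ i x → Priv i x → ¬ Common x) →
  totalV h v ≤ B →
  (∀ j X → count X ≤ B → ¬ ¬ Σ (F j ⊆ G) λ f → ∀ a →
    Priv j (proj₁ f a) ⊎ (Common (proj₁ f a) × X (proj₁ f a) ≡ false)) →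
  ¬ ¬ Σ (⋃ h v F ⊆ G) λ f → ∀ a → (∃ λ j → Priv j (proj₁ f a)) ⊎ Common (proj₁ f a)
greedy-embed G B zero v F Priv Common apart apart′ size place none =
  none (((λ ()) , (λ { {()} }) , λ ()) , λ ())
greedy-embed {n} G B (suc h) v F Priv Common apart apart′ size place none =
  greedy-embed G B h (v ∘ suc) (F ∘ suc) (Priv ∘ suc) Common
    (λ i j x p p′ → suc-injective (apart (suc i) (suc j) x p p′)) (apart′ ∘ suc) size′ (place ∘ suc)
    λ { (g , g-in) → place zero (img (proj₁ g))
          (≤-trans (≤-reflexive (count-img (proj₁ g) (proj₁ (proj₂ g)))) size′)
          λ { (f , f-in) →
            let e , image = embed-⊎ {A = F zero} {⋃ h v′ (F ∘ suc)} {G} f g (disjoint f g f-in g-in) in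
            none (e , λ x → located f g f-in g-in (proj₁ e x) (image x)) } }
  where
  v′ : Fin h → ℕ
  v′ = v ∘ suc
  size′ : totalV h v′ ≤ B
  size′ = ≤-trans (m≤n+m _ (v zero)) size
  InF : F zero ⊆ G → ⋃ h v′ (F ∘ suc) ⊆ G → Set
  InF f g = ∀ a → Priv zero (proj₁ f a) ⊎ (Common (proj₁ f a) × img (proj₁ g) (proj₁ f a) ≡ false)
  InG : ⋃ h v′ (F ∘ suc) ⊆ G → Set
  InG g = ∀ b → (∃ λ j → Priv (suc j) (proj₁ g b)) ⊎ Common (proj₁ g b)
  disjoint : ∀ f g → InF f g → InG g → ∀ a b → proj₁ f a ≢ proj₁ g b
  disjoint f g f-in g-in a b eq with f-in a | g-in b
  ... | inj₂ (_ , out) | _ = img-∉ (proj₁ g) _ out b (sym eq)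
  ... | inj₁ priv | inj₂ com = apart′ zero _ (subst (Priv zero) eq priv) com
  ... | inj₁ priv | inj₁ (j , priv′) with apart zero (suc j) _ (subst (Priv zero) eq priv) priv′
  ...   | ()
  located : ∀ f g → InF f g → InG g → ∀ x →
    (∃ λ a → x ≡ proj₁ f a) ⊎ (∃ λ b → x ≡ proj₁ g b) → (∃ λ j → Priv j x) ⊎ Common x
  located f g f-in g-in x (inj₁ (a , refl)) with f-in a
  ... | inj₁ priv      = inj₁ (zero , priv)
  ... | inj₂ (com , _) = inj₂ com
  located f g f-in g-in x (inj₂ (b , refl)) with g-in b
  ... | inj₁ (j , priv) = inj₁ (suc j , priv)
  ... | inj₂ com        = inj₂ com

inj₁≢inj₂ : ∀ {A B : Set} {a : A} {b : B} → inj₁ a ≢ inj₂ b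
inj₁≢inj₂ ()

↑ˡ≢↑ʳ : ∀ m n (i : Fin m) (j : Fin n) → i ↑ˡ n ≢ m ↑ʳ j
↑ˡ≢↑ʳ m n i j eq =
  inj₁≢inj₂ (trans (sym (splitAt-↑ˡ m i n)) (trans (cong (splitAt m) eq) (splitAt-↑ʳ m n j)))

component : ∀ h v (i : Fin h) → Fin (v i) → Fin (totalV h v)
component (suc h) v zero    a = a ↑ˡ totalV h (v ∘ suc)
component (suc h) v (suc i) a = v zero ↑ʳ component h (v ∘ suc) i a

component-disjoint : ∀ h v i j a b → component h v i a ≡ component h v j b → i ≡ j
component-disjoint (suc h) v zero    zero    a b eq = refl
component-disjoint (suc h) v zero    (suc j) a b eq = ⊥-elim (↑ˡ≢↑ʳ (v zero) _ a _ eq)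
component-disjoint (suc h) v (suc i) zero    a b eq = ⊥-elim (↑ˡ≢↑ʳ (v zero) _ b _ (sym eq))
component-disjoint (suc h) v (suc i) (suc j) a b eq =
  cong suc (component-disjoint h (v ∘ suc) i j a b (↑ʳ-injective (v zero) _ _ eq))

component-⊆ : ∀ h v (F : (i : Fin h) → Graph (v i)) i → F i ⊆ ⋃ h v F
component-⊆ h v F i = component h v i , injective h v i , λ a b ab → trans (adjacent h v F i a b) ab
  where
  injective : ∀ h v i → Injective′ (component h v i)
  injective (suc h) v zero    eq = ↑ˡ-injective (totalV h (v ∘ suc)) _ _ eq
  injective (suc h) v (suc i) eq = injective h (v ∘ suc) i (↑ʳ-injective (v zero) _ _ eq)
  adjacent : ∀ h v (F : (i : Fin h) → Graph (v i)) i a b →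
    adj (⋃ h v F) (component h v i a) (component h v i b) ≡ adj (F i) a b
  adjacent (suc h) v F zero a b = cong₂ (Defs.combine _ _ false)
    (splitAt-↑ˡ (v zero) a (totalV h (v ∘ suc))) (splitAt-↑ˡ (v zero) b (totalV h (v ∘ suc)))
  adjacent (suc h) v F (suc i) a b = trans (cong₂ (Defs.combine _ _ false)
      (splitAt-↑ʳ (v zero) (totalV h (v ∘ suc)) (component h (v ∘ suc) i a))
      (splitAt-↑ʳ (v zero) (totalV h (v ∘ suc)) (component h (v ∘ suc) i b)))
    (adjacent h (v ∘ suc) (F ∘ suc) i a b)

⊆-trans : ∀ {k m n} {A : Graph k} {B : Graph m} {C : Graph n} → A ⊆ B → B ⊆ C → A ⊆ C
⊆-trans (f , f-inj , f-hom) (g , g-inj , g-hom) =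
  g ∘ f , f-inj ∘ g-inj , λ i j ij → g-hom _ _ (f-hom i j ij)

-- A copy avoiding the clique would lie in `H`.
meets-clique : ∀ {k m j} {F : Graph k} (H : Graph m) → Free F H → ((f , _) : F ⊆ (K j ∏ H)) →
  ∃ λ a → ∃ λ x → splitAt j (f a) ≡ inj₁ x
meets-clique {k} {m} {j} {F} H free (f , inj , hom) with any? (λ a → left? (splitAt j (f a)))
  where
  left? : (s : Fin j ⊎ Fin m) → Dec (∃ λ x → s ≡ inj₁ x)
  left? (inj₁ x) = yes (x , refl)
  left? (inj₂ y) = no λ ()
... | yes found = found
... | no none = ⊥-elim (free (proj₁ ∘ right , g-inj , g-hom))
  where
  right : ∀ a → ∃ λ y → splitAt j (f a) ≡ inj₂ y
  right a with splitAt j (f a) in eq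
  ... | inj₁ x = ⊥-elim (none (a , x , eq))
  ... | inj₂ y = y , refl
  g-inj : Injective′ (proj₁ ∘ right)
  g-inj {a} {b} eq = inj (trans (sym (splitAt⁻¹-↑ʳ (proj₂ (right a))))
    (trans (cong (j ↑ʳ_) eq) (splitAt⁻¹-↑ʳ (proj₂ (right b)))))
  g-hom : ∀ a b → adj F a b ≡ true → adj H (proj₁ (right a)) (proj₁ (right b)) ≡ true
  g-hom a b ab = trans (sym (cong₂ (Defs.combine (adj (K j)) (adj H) true)
    (proj₂ (right a)) (proj₂ (right b)))) (hom a b ab)

-- Each of F 0, …, F j needs its own vertex of the clique, which has only j of them.
join-free : ∀ h v (F : (i : Fin h) → Graph (v i)) (j : Fin h) {m} (H : Graph m) →
  (∀ i → toℕ i ≤ toℕ j → Free (F i) H) → Free (⋃ h v F) (K (toℕ j) ∏ H)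
join-free h v F j {m} H free sub@(f , f-inj , f-hom) = 1+n≰n (injective⇒≤ {f = clique} clique-injective)
  where
  index : Fin (suc (toℕ j)) → Fin h
  index i = fromℕ< (≤-trans (toℕ<n i) (toℕ<n j))
  toℕ-index : ∀ i → toℕ (index i) ≡ toℕ i
  toℕ-index i = toℕ-fromℕ< (≤-trans (toℕ<n i) (toℕ<n j))
  meet : ∀ i → ∃ λ a → ∃ λ x → splitAt (toℕ j) (f (component h v (index i) a)) ≡ inj₁ x
  meet i = meets-clique {F = F (index i)} H
    (free (index i) (≤-trans (≤-reflexive (toℕ-index i)) (≤-pred (toℕ<n i))))
    (⊆-trans {A = F (index i)} {B = ⋃ h v F} {C = K (toℕ j) ∏ H} (component-⊆ h v F (index i)) sub)
  clique : Fin (suc (toℕ j)) → Fin (toℕ j)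
  clique i = proj₁ (proj₂ (meet i))
  clique-injective : Injective′ clique
  clique-injective {i} {i′} eq = toℕ-injective (trans (sym (toℕ-index i)) (trans (cong toℕ
    (component-disjoint h v (index i) (index i′) (proj₁ (meet i)) (proj₁ (meet i′))
      (f-inj (trans (sym (splitAt⁻¹-↑ˡ (proj₂ (proj₂ (meet i)))))
        (trans (cong (_↑ˡ m) eq) (splitAt⁻¹-↑ˡ (proj₂ (proj₂ (meet i′))))))))) (toℕ-index i′)))

-- Comparison of edge numbers

extremal-edges : ∀ {k n} {F : Graph k} (G G′ : Graph n) → IsEX n F G → IsEX n F G′ → edges G ≡ edges G′
extremal-edges G G′ (free , max) (free′ , max′) = ≤-antisym (max′ G free) (max G′ free′)

injective⇒surjective : ∀ {m n} (f : Fin m → Fin n) → Injective′ f → m ≡ n → ∀ y → ∃ λ x → f x ≡ y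
injective⇒surjective {m} {n} f inj m≡n y with bool? (img f y)
... | inj₁ y∈ = img-preimage f y y∈
... | inj₂ y∉ = ⊥-elim (<-irrefl refl (begin-strict
  n                                    ≡⟨ sym (trans (count-img f inj) m≡n) ⟩
  count (img f)                        <⟨ m<m+n _ (≤-trans (≤-reflexive (cong (⟦_⟧ ∘ not) (sym y∉)))
                                            (Σ-member n (λ x → ⟦ not (img f x) ⟧) y)) ⟩
  count (img f) + count (not ∘ img f)  ≡⟨ count-not (img f) ⟩
  n                                    ∎))
  where open ≤-Reasoning

-- A universal vertex gains about n/r over any other vertex; m is all but P of the n vertices.
gain : ∀ {J P n} s t u g q m → J ≡ suc s + t → P ≡ J + u → n ≡ P + m → suc (2 * P) ≤ q →
  (let R = suc q + suc g) →
  R * (J * (u + m)) + u * (g * m) + P * (q * n) ≤ P * (R * n) + s * (q * n) →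
  m ≤ P * (R * P) + s * (q * P)
gain {J} {P} s t u g q m refl refl refl 2P<q le =
  ≤-from _ _ (R * (J * u) + P * (q * P) + m * (t * q + 2 * J))
    (+-mono-≤ le (*-monoʳ-≤ m 2P<q)) (ident s t u g q m)
  where
  R : ℕ
  R = suc q + suc g
  ident : ∀ s t u g q m →
    m + (((suc s + t + u) * ((suc q + suc g) * (suc s + t + u + m)) + s * (q * (suc s + t + u + m))) + m * q)
      + ((suc q + suc g) * ((suc s + t) * u) + (suc s + t + u) * (q * (suc s + t + u)) + m * (t * q + 2 * (suc s + t)))
    ≡ ((suc s + t + u) * ((suc q + suc g) * (suc s + t + u)) + s * (q * (suc s + t + u)))
      + (((suc q + suc g) * ((suc s + t) * (u + m)) + u * (g * m) + (suc s + t + u) * (q * (suc s + t + u + m)))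
        + m * suc (2 * (suc s + t + u)))
  ident = solve-∀

-- Only an inequality, because edges between two deleted vertices are counted twice; the discarded
-- term of `form-split` is `form a out out`.
edges-delete : ∀ {m n} (G : Graph n) (e : Fin m → Fin n) → Injective′ e →
  edges G ≤ edges (pullback G e) + Σᶠ n (λ x → ⟦ not (img e x) ⟧ * count (adj G x))
edges-delete {m} {n} G e inj = double-cancel-≤ (begin
  edges G + edges G
    ≡⟨ trans (handshake G) (sym ones) ⟩
  form a (λ _ → 1) (λ _ → 1)
    ≤⟨ m≤m+n _ (form a out out) ⟩
  form a (λ _ → 1) (λ _ → 1) + form a out out
    ≡⟨ form-split a (λ i j → cong ⟦_⟧ (adjSym G i j)) (λ _ → 1) (⟦_⟧ ∘ img e) out (λ x → sym (⟦not⟧ (img e x))) ⟩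
  form a (⟦_⟧ ∘ img e) (⟦_⟧ ∘ img e) + 2 * form a out (λ _ → 1)
    ≡⟨ cong₂ (λ x y → x + 2 * y) kept lost ⟩
  adjSum (pullback G e) + 2 * X
    ≡⟨ cong (_+ 2 * X) (sym (handshake (pullback G e))) ⟩
  (edges (pullback G e) + edges (pullback G e)) + 2 * X
    ≡⟨ ident (edges (pullback G e)) X ⟩
  (edges (pullback G e) + X) + (edges (pullback G e) + X) ∎)
  where
  open ≤-Reasoning
  a : Fin n → Fin n → ℕ
  a i j = ⟦ adj G i j ⟧
  out : Fin n → ℕ
  out x = ⟦ not (img e x) ⟧
  X : ℕ
  X = Σᶠ n (λ x → out x * count (adj G x))
  deg : ∀ x → Σᶠ n (λ j → 1 * a x j) ≡ count (adj G x)
  deg x = Σ-cong n (λ j → *-identityˡ (a x j))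
  ones : form a (λ _ → 1) (λ _ → 1) ≡ adjSum G
  ones = Σ-cong n (λ i → trans (*-identityˡ _) (deg i))
  lost : form a out (λ _ → 1) ≡ X
  lost = Σ-cong n (λ i → cong (out i *_) (deg i))
  kept : form a (⟦_⟧ ∘ img e) (⟦_⟧ ∘ img e) ≡ adjSum (pullback G e)
  kept = trans (Σ-cong n (λ i → cong (⟦ img e i ⟧ *_) (Σ-img e inj (a i))))
    (Σ-img e inj (λ i → Σᶠ m (λ j → a i (e j))))
  ident : ∀ y x → (y + y) + 2 * x ≡ (y + x) + (y + x)
  ident = solve-∀

-- Structure of an extremal graph of the disjoint union

module _ (h p′ : ℕ) (v : Fin h → ℕ) (F : (i : Fin h) → Graph (v i))
         (A : ∀ i → Apex (F i) (suc (suc p′))) where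

  private
    p r V : ℕ
    p = suc p′
    r = suc p
    V = totalV h v

  v≤V : ∀ i → v i ≤ V
  v≤V i = injective⇒≤ {f = component h v i} (proj₁ (proj₂ (component-⊆ h v F i)))

  -- The copies of F 0, …, F (c − 1) pass through w 0, …, w (c − 1), and X₀ is reserved for F c.
  heavy-embed : ∀ {n} (G : Graph n) c (w : Fin c → Fin n) → Injective′ w → c ≤ h → ∀ T →
    V + (V + (V + h)) ≤ T → (∀ i → Multipartite G (adj G (w i)) r T) →
    (X₀ : Fin n → Bool) → count X₀ ≤ V → (∀ i → X₀ (w i) ≡ false) →
    (∀ j → c ≤ toℕ j → ∀ X → count X ≤ V → ¬ ¬ Σ (F j ⊆ G) λ f → ∀ a →
      (toℕ j ≡ c × X₀ (proj₁ f a) ≡ true) ⊎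
      ((img w (proj₁ f a) ≡ false × X₀ (proj₁ f a) ≡ false) × X (proj₁ f a) ≡ false)) →
    ¬ ¬ (⋃ h v F ⊆ G)
  heavy-embed {n} G c w w-inj c≤h T T≥ multi X₀ X₀-size X₀-w place none =
    greedy-embed G V h v F Priv Common apart apart′ ≤-refl place′ (λ { (f , _) → none f })
    where
    Priv : Fin h → Fin n → Set
    Priv j x = (∃ λ i → toℕ i ≡ toℕ j × w i ≡ x) ⊎ (toℕ j ≡ c × X₀ x ≡ true)
    Common : Fin n → Set
    Common x = img w x ≡ false × X₀ x ≡ false
    apart : ∀ i j x → Priv i x → Priv j x → i ≡ j
    apart i j x (inj₁ (a , a≡ , wa)) (inj₁ (b , b≡ , wb)) =
      toℕ-injective (trans (sym a≡) (trans (cong toℕ (w-inj (trans wa (sym wb)))) b≡))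
    apart i j x (inj₁ (a , _ , wa)) (inj₂ (_ , x∈)) =
      ⊥-elim (true≢false x∈ (trans (cong X₀ (sym wa)) (X₀-w a)))
    apart i j x (inj₂ (_ , x∈)) (inj₁ (a , _ , wa)) =
      ⊥-elim (true≢false x∈ (trans (cong X₀ (sym wa)) (X₀-w a)))
    apart i j x (inj₂ (i≡ , _)) (inj₂ (j≡ , _)) = toℕ-injective (trans i≡ (sym j≡))
    apart′ : ∀ i x → Priv i x → ¬ Common x
    apart′ i x (inj₁ (a , _ , wa)) (out , _) = img-∉ w x out a wa
    apart′ i x (inj₂ (_ , x∈)) (_ , out) = true≢false x∈ out
    place′ : ∀ j X → count X ≤ V → ¬ ¬ Σ (F j ⊆ G) λ f → ∀ a →
      Priv j (proj₁ f a) ⊎ (Common (proj₁ f a) × X (proj₁ f a) ≡ false)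
    place′ j X X-size none with toℕ j <? c
    ... | no ¬lt = place j (≮⇒≥ ¬lt) X X-size λ { (f , f-in) → none (f , λ a → weaken (f-in a)) }
      where
      weaken : ∀ {B C : Set} {x} → (toℕ j ≡ c × X₀ x ≡ true) ⊎ (B × C) → Priv j x ⊎ (B × C)
      weaken (inj₁ y) = inj₁ (inj₂ y)
      weaken (inj₂ y) = inj₂ y
    ... | yes lt = none (f , f-in)
      where
      i : Fin c
      i = fromℕ< lt
      Z : Fin n → Bool
      Z x = X x ∨ (X₀ x ∨ img w x)
      Z-size : v j + count Z ≤ T
      Z-size = begin
        v j + count Z                                ≤⟨ +-mono-≤ (v≤V j) (count-∨ X (λ x → X₀ x ∨ img w x)) ⟩
        V + (count X + count (λ x → X₀ x ∨ img w x)) ≤⟨ +-monoʳ-≤ V (+-mono-≤ X-size (≤-trans (count-∨ X₀ (img w))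
                                                          (+-mono-≤ X₀-size (≤-trans (≤-reflexive (count-img w w-inj)) c≤h)))) ⟩
        V + (V + (V + h))                            ≤⟨ T≥ ⟩
        T                                            ∎
        where open ≤-Reasoning
      embedded : Σ (F j ⊆ G) λ f → ∀ a → proj₁ f a ≡ w i ⊎ adj G (w i) (proj₁ f a) ∧ not (Z (proj₁ f a)) ≡ true
      embedded = apex-embed (A j) G (w i) (λ x x∈ → proj₁ (∧-true x∈)) (avoid Z Z-size (multi i))
      f : F j ⊆ G
      f = proj₁ embedded
      f-in : ∀ a → Priv j (proj₁ f a) ⊎ (Common (proj₁ f a) × X (proj₁ f a) ≡ false)
      f-in a with proj₂ embedded a
      ... | inj₁ eq = inj₁ (inj₁ (i , toℕ-fromℕ< lt , sym eq))
      ... | inj₂ x∈ =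
        let X∌ , rest  = ∨-false {X (proj₁ f a)} (not-true (proj₂ (∧-true {adj G (w i) (proj₁ f a)} x∈)))
            X₀∌ , w∌   = ∨-false {X₀ (proj₁ f a)} rest
        in inj₂ ((w∌ , X₀∌) , X∌)

  module _ (N₁ : ℕ)
           (ord : ∀ N → N₁ ≤ N → ∀ (ℓ : Fin h) →
              Σ (Graph N) λ H → IsEX N (F ℓ) H × (∀ (j : Fin h) → toℕ j ≤ toℕ ℓ → Free (F j) H)) where

    -- Proper ordering supplies an extremal graph for `F j` that avoids the earlier graphs as well,
    -- so `join-free` applies to its join. It has as many edges as `H`, which need not avoid them.
    competitor : ∀ {n} (G : Graph n) → IsEX n (⋃ h v F) G → ∀ j → toℕ j ≤ n → N₁ ≤ n ∸ toℕ j →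
      (H : Graph (n ∸ toℕ j)) → IsEX (n ∸ toℕ j) (F j) H →
      toℕ j C 2 + toℕ j * (n ∸ toℕ j) + edges H ≤ edges G
    competitor {n} G (_ , max) j j≤n N₁≤ H exH =
      let H* , exH* , free* = ord (n ∸ toℕ j) N₁≤ j
          n≡ = m+[n∸m]≡n j≤n
          J* = K (toℕ j) ∏ H*
      in begin
        toℕ j C 2 + toℕ j * (n ∸ toℕ j) + edges H
          ≡⟨ cong (toℕ j C 2 + toℕ j * (n ∸ toℕ j) +_) (extremal-edges {F = F j} H H* exH exH*) ⟩
        toℕ j C 2 + toℕ j * (n ∸ toℕ j) + edges H*
          ≡⟨ sym (edges-join (toℕ j) H*) ⟩
        edges J*
          ≡⟨ sym (edges-cast n≡ J*) ⟩
        edges (castGraph n≡ J*)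
          ≤⟨ max (castGraph n≡ J*) (λ sub → join-free h v F j H* free* (⊆-uncast n≡ {⋃ h v F} J* sub)) ⟩
        edges G ∎
      where open ≤-Reasoning

    module _ (q₀ : ℕ)
             (grow : ∀ i {m} → N₁ ≤ m → (H : Graph m) (H′ : Graph (suc m)) → IsEX m (F i) H →
                IsEX (suc m) (F i) H′ →
                r * suc q₀ * (edges H + m) ≤ r * suc q₀ * edges H′ + suc (suc q₀) * m) where

      private
        -- In units of 1/R, `grow` adds at least gm edges per new vertex, where g = R - q₁ - 1 is a
        -- natural number because r ≥ 2. A vertex outside `W` has at most (R - q₀)n.
        q₁ g R : ℕ
        q₁ = suc q₀
        g  = q₀ + p′ * suc q₀
        R  = r * q₁

        R≡ : R ≡ q₁ + suc g
        R≡ = refl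

      -- `ord` provides extremal graphs of the intermediate orders, and each increment is bounded
      -- below by its value at the smallest order `m`.
      grows : ∀ i {m} → N₁ ≤ m → (H : Graph m) → IsEX m (F i) H → ∀ u (H′ : Graph (u + m)) →
        IsEX (u + m) (F i) H′ → R * edges H + u * (g * m) ≤ R * edges H′
      grows i {m} N₁≤m H exH zero H′ exH′ =
        ≤-reflexive (trans (+-identityʳ _) (cong (R *_) (extremal-edges {F = F i} H H′ exH exH′)))
      grows i {m} N₁≤m H exH (suc u) H′ exH′ =
        let H₁ , exH₁ , _ = ord (u + m) (≤-trans N₁≤m (m≤n+m m u)) i
        in ≤-from _ _ (g * u)
          (+-mono-≤ (grows i N₁≤m H exH u H₁ exH₁)
            (subst (λ x → x * (edges H₁ + (u + m)) ≤ x * edges H′ + suc q₁ * (u + m)) R≡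
              (grow i (≤-trans N₁≤m (m≤n+m m u)) H₁ H′ exH₁ exH′)))
          (trans (cong (λ x → x * edges H + suc u * (g * m) + (x * edges H₁ + (x * edges H′ + suc q₁ * (u + m))) + g * u) R≡)
            (trans (ident q₁ g (edges H) (edges H₁) (edges H′) u m)
              (cong (λ x → x * edges H′ + (x * edges H + u * (g * m) + (q₁ + suc g) * (edges H₁ + (u + m)))) (sym R≡))))
        where
        ident : ∀ q g e e₁ e′ u m →
          (q + suc g) * e + suc u * (g * m) + ((q + suc g) * e₁ + ((q + suc g) * e′ + suc q * (u + m))) + g * u
          ≡ (q + suc g) * e′ + ((q + suc g) * e + u * (g * m) + (q + suc g) * (e₁ + (u + m)))
        ident = solve-∀

      module _ {n} (G : Graph n) (ex : IsEX n (⋃ h v F) G) (P m T : ℕ) (n≡ : n ≡ P + m)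
               (P≥ : h + (V + V) ≤ P) (2P<q₀ : suc (2 * P) ≤ q₀) (N₁≤m : N₁ ≤ m)
               (m-large : P * (R * P) + P * (q₀ * P) < m) (T≥ : V + (V + (V + h)) ≤ T)
               (a₀ : ℕ) (light : ∀ {d} → ¬ d ≤ a₀ → q₀ * n ≤ q₁ * (r * d))
               (heavies : ∀ c → c ≤ h → c ≤ count (λ x → does (nonDegree G x ≤? a₀)) →
                  Σ (Fin c → Fin n) λ w → Injective′ w ×
                    (∀ i → nonDegree G (w i) ≤ a₀ × Multipartite G (adj G (w i)) r T)) where

        private
          W : Fin n → Bool
          W x = does (nonDegree G x ≤? a₀)

          s : ℕ
          s = count W

          h≤P : h ≤ P
          h≤P = ≤-trans (m≤m+n h (V + V)) P≥

          P≤n : P ≤ n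
          P≤n = ≤-trans (m≤m+n P m) (≤-reflexive (sym n≡))

          few-heavy : s < h
          few-heavy = ≰⇒> λ h≤s →
            let w , w-inj , heavy = heavies h ≤-refl h≤s in
            -- Every component has its own heavy vertex, so nothing is reserved and no index is left
            -- for the last argument.
            heavy-embed G h w w-inj ≤-refl T T≥ (proj₂ ∘ heavy) (λ _ → false)
              (≤-trans (≤-reflexive (Σ-zero n)) z≤n) (λ _ → refl)
              (λ j h≤j → ⊥-elim (<⇒≱ (toℕ<n j) h≤j)) (proj₁ ex)

          weight : ∀ x → R * count (adj G x) + q₀ * n ≤ R * n + ⟦ W x ⟧ * (q₀ * n)
          weight x = go (W x) refl
            where
            open ≤-Reasoning
            deg : R * n ≡ R * count (adj G x) + R * nonDegree G x
            deg = trans (cong (R *_) (sym (degree+nonDegree G x))) (*-distribˡ-+ R (count (adj G x)) _)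
            swap : ∀ a b c → a * b * c ≡ b * (a * c)
            swap = solve-∀
            go : ∀ b → W x ≡ b → R * count (adj G x) + q₀ * n ≤ R * n + ⟦ b ⟧ * (q₀ * n)
            go true  eq = +-mono-≤ (*-monoʳ-≤ R (count≤n (adj G x))) (≤-reflexive (sym (*-identityˡ (q₀ * n))))
            go false eq = begin
              R * count (adj G x) + q₀ * n            ≤⟨ +-monoʳ-≤ _ (light
                                                           (does-false (nonDegree G x ≤? a₀) eq)) ⟩
              R * count (adj G x) + q₁ * (r * nonDegree G x) ≡⟨ cong (R * count (adj G x) +_) (sym (swap r q₁ _)) ⟩
              R * count (adj G x) + R * nonDegree G x ≡⟨ sym deg ⟩
              R * n                                   ≡⟨ sym (+-identityʳ _) ⟩
              R * n + 0                               ∎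

          weights : (out : Fin n → Bool) →
            R * Σᶠ n (λ x → ⟦ out x ⟧ * count (adj G x)) + count out * (q₀ * n)
            ≤ count out * (R * n) + s * (q₀ * n)
          weights out = begin
            R * Σᶠ n (λ x → ⟦ out x ⟧ * count (adj G x)) + count out * (q₀ * n)
              ≡⟨ cong₂ _+_ (sym (Σ-*ˡ n R _)) (sym (Σ-*ʳ n (q₀ * n) (⟦_⟧ ∘ out))) ⟩
            Σᶠ n (λ x → R * (⟦ out x ⟧ * count (adj G x))) + Σᶠ n (λ x → ⟦ out x ⟧ * (q₀ * n))
              ≡⟨ sym (Σ-+ n _ _) ⟩
            Σᶠ n (λ x → R * (⟦ out x ⟧ * count (adj G x)) + ⟦ out x ⟧ * (q₀ * n))
              ≤⟨ Σ-mono n (λ x → pointwise (out x) {R} (weight x)) ⟩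
            Σᶠ n (λ x → ⟦ out x ⟧ * (R * n) + ⟦ W x ⟧ * (q₀ * n))
              ≡⟨ trans (Σ-+ n _ _) (cong₂ _+_ (Σ-*ʳ n (R * n) (⟦_⟧ ∘ out)) (Σ-*ʳ n (q₀ * n) (⟦_⟧ ∘ W))) ⟩
            count out * (R * n) + s * (q₀ * n) ∎
            where
            open ≤-Reasoning
            pointwise : ∀ b {R d x y z} → R * d + x ≤ y + z → R * (⟦ b ⟧ * d) + ⟦ b ⟧ * x ≤ ⟦ b ⟧ * y + z
            pointwise true  {R} {d} {x} {y} {z} le = subst₂ _≤_
              (cong₂ (λ a b → R * a + b) (sym (*-identityˡ d)) (sym (*-identityˡ x)))
              (cong (_+ z) (sym (*-identityˡ y))) le
            pointwise false {R} _ = ≤-trans (≤-reflexive (trans (+-identityʳ (R * 0)) (*-zeroʳ R))) z≤n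

          -- Otherwise replacing G by K j ∏ H with H extremal for F j would gain edges.
          spare : ∀ j → s < toℕ j → (Z : Fin n → Bool) → count Z ≤ P →
            ¬ ¬ Σ (F j ⊆ G) λ f → ∀ a → Z (proj₁ f a) ≡ false
          spare j s<j Z Z≤P none = <⇒≱ m-large (≤-trans
            (gain {J} {P} {n} s (J ∸ suc s) u g q₀ m (sym (m+[n∸m]≡n s<j)) (sym J+u) n≡ 2P<q₀
              (≤-from _ _ 0 (+-mono-≤ upper (+-mono-≤ lower′ (+-mono-≤ growth outer)))
                (ident R (edges G) (edges Hₘ) X J (u + m) (edges Hⱼ) (u * (g * m)) (P * (q₀ * n)) (P * (R * n)) (s * (q₀ * n)))))
            (+-monoʳ-≤ (P * (R * P)) (*-monoˡ-≤ (q₀ * P) (≤-trans (<⇒≤ few-heavy) h≤P))))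
            where
            J u : ℕ
            J = toℕ j
            u = P ∸ J
            J+u : J + u ≡ P
            J+u = m+[n∸m]≡n (≤-trans (<⇒≤ (toℕ<n j)) h≤P)
            -- Keeping exactly `m` vertices outside `Z` enlarges the deleted set to exactly `P`
            -- vertices, which fixes the orders to be compared.
            room : m ≤ count (not ∘ Z)
            room = +-cancelˡ-≤ P m _ (≤-trans (≤-reflexive (trans (sym n≡) (sym (count-not Z)))) (+-monoˡ-≤ _ Z≤P))
            chosen : Σ (Fin m → Fin n) λ e → Injective′ e × (∀ a → not (Z (e a)) ≡ true)
            chosen = choose (not ∘ Z) room
            e : Fin m → Fin n
            e = proj₁ chosen
            e-inj : Injective′ e
            e-inj = proj₁ (proj₂ chosen)
            out : Fin n → Bool
            out x = not (img e x)
            X : ℕ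
            X = Σᶠ n (λ x → ⟦ out x ⟧ * count (adj G x))
            out-size : count out ≡ P
            out-size = +-cancelˡ-≡ m _ _ (trans (cong (_+ count out) (sym (count-img e e-inj)))
              (trans (count-not (img e)) (trans n≡ (+-comm P m))))
            Hₘ : Graph m
            Hₘ = proj₁ (ord m N₁≤m j)
            exₘ : IsEX m (F j) Hₘ
            exₘ = proj₁ (proj₂ (ord m N₁≤m j))
            N₁≤u+m : N₁ ≤ u + m
            N₁≤u+m = ≤-trans N₁≤m (m≤n+m m u)
            Hⱼ : Graph (u + m)
            Hⱼ = proj₁ (ord (u + m) N₁≤u+m j)
            exⱼ : IsEX (u + m) (F j) Hⱼ
            exⱼ = proj₁ (proj₂ (ord (u + m) N₁≤u+m j))
            upper : R * edges G ≤ R * (edges Hₘ + X)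
            upper = *-monoʳ-≤ R (≤-trans (edges-delete G e e-inj) (+-monoˡ-≤ X
              (proj₂ exₘ (pullback G e) (λ sub →
                let f , f≡ = ⊆-pullback {F = F j} G e e-inj sub in
                none (f , λ a → trans (cong Z (f≡ a)) (not-true (proj₂ (proj₂ chosen) (proj₁ sub a))))))))
            n∸J : u + m ≡ n ∸ J
            n∸J = sym (trans (cong (_∸ J) (trans n≡ (trans (cong (_+ m) (sym J+u)) (+-assoc J u m)))) (m+n∸m≡n J (u + m)))
            compete : ∀ {N} → N ≡ n ∸ J → N₁ ≤ N → (H : Graph N) → IsEX N (F j) H → J * N + edges H ≤ edges G
            compete refl N₁≤ H exH = ≤-trans (+-monoˡ-≤ (edges H) (m≤n+m _ (J C 2)))
              (competitor G ex j (≤-trans (≤-trans (<⇒≤ (toℕ<n j)) h≤P) P≤n) N₁≤ H exH)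
            lower′ : R * (J * (u + m) + edges Hⱼ) ≤ R * edges G
            lower′ = *-monoʳ-≤ R (compete n∸J N₁≤u+m Hⱼ exⱼ)
            growth : R * edges Hₘ + u * (g * m) ≤ R * edges Hⱼ
            growth = grows j N₁≤m Hₘ exₘ u Hⱼ exⱼ
            outer : R * X + P * (q₀ * n) ≤ P * (R * n) + s * (q₀ * n)
            outer = subst (λ c → R * X + c * (q₀ * n) ≤ c * (R * n) + s * (q₀ * n)) out-size (weights out)
            ident : ∀ R G Hm X J U Hj a b c d →
              R * (J * U) + a + b + (R * (Hm + X) + (R * G + (R * Hj + (c + d)))) + 0
              ≡ c + d + (R * G + (R * (J * U + Hj) + ((R * Hm + a) + (R * X + b))))
            ident = solve-∀

          -- Indices start at 0, so index `s` is the graph that the theorem pairs with a clique on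
          -- `s` vertices.
          ℓ : Fin h
          ℓ = fromℕ< few-heavy

          ℓ≡s : toℕ ℓ ≡ s
          ℓ≡s = toℕ-fromℕ< few-heavy

          rest-free : ∀ {k} (e : Fin k → Fin n) → Injective′ e → (∀ a → W (e a) ≡ false) →
            Free (F ℓ) (pullback G e)
          rest-free e e-inj e∉W sub =
            let w , w-inj , heavy = heavies s (<⇒≤ few-heavy) ≤-refl
                w∈W = λ i → dec-true (nonDegree G (w i) ≤? a₀) (proj₁ (heavy i))
            in heavy-embed G s w w-inj (<⇒≤ few-heavy) T T≥ (proj₂ ∘ heavy) X₀
                 (≤-trans (≤-reflexive (count-img f (proj₁ (proj₂ φ)))) (v≤V ℓ))
                 (λ i → X₀-light (w i) (w∈W i)) (place w w∈W) (proj₁ ex)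
            where
            φ : F ℓ ⊆ G
            φ = proj₁ (⊆-pullback {F = F ℓ} G e e-inj sub)
            f : Fin (v ℓ) → Fin n
            f = proj₁ φ
            X₀ : Fin n → Bool
            X₀ = img f
            X₀-light : ∀ x → W x ≡ true → X₀ x ≡ false
            X₀-light x x∈W with bool? (X₀ x)
            ... | inj₂ out = out
            ... | inj₁ x∈ = let a , eq = img-preimage f x x∈ in
              ⊥-elim (true≢false x∈W (trans (cong W (sym eq)) (e∉W (proj₁ sub a))))
            place : (w : Fin s → Fin n) → (∀ i → W (w i) ≡ true) →
              ∀ j → s ≤ toℕ j → ∀ X → count X ≤ V → ¬ ¬ Σ (F j ⊆ G) λ f → ∀ a →
              (toℕ j ≡ s × X₀ (proj₁ f a) ≡ true) ⊎
              ((img w (proj₁ f a) ≡ false × X₀ (proj₁ f a) ≡ false) × X (proj₁ f a) ≡ false)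
            -- The copy found outside `W` serves index `s` itself; larger indices are placed by
            -- `spare` outside `W`, `X₀` and `X`.
            place w w∈W j s≤j X X-size none with s <? toℕ j
            ... | no ¬lt = reserved (toℕ-injective (trans ℓ≡s (≤-antisym s≤j (≮⇒≥ ¬lt))))
              where
              reserved : ℓ ≡ j → ⊥
              reserved refl = none (φ , λ a → inj₁ (ℓ≡s , img-∈ f a))
            ... | yes lt = spare j lt Z Z-size λ { (f′ , avoids) → none (f′ , λ a →
                let W∌ , rest = ∨-false {W (proj₁ f′ a)} (avoids a)
                    X₀∌ , X∌  = ∨-false {X₀ (proj₁ f′ a)} rest
                in inj₂ ((unheavy (proj₁ f′ a) W∌ , X₀∌) , X∌)) }
              where
              Z : Fin n → Bool
              Z x = W x ∨ (X₀ x ∨ X x)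
              Z-size : count Z ≤ P
              Z-size = ≤-trans (count-∨ W (λ x → X₀ x ∨ X x)) (≤-trans
                (+-mono-≤ (<⇒≤ few-heavy) (≤-trans (count-∨ X₀ X) (+-mono-≤
                  (≤-trans (≤-reflexive (count-img f (proj₁ (proj₂ φ)))) (v≤V ℓ)) X-size))) P≥)
              unheavy : ∀ x → W x ≡ false → img w x ≡ false
              unheavy x x∉ with bool? (img w x)
              ... | inj₂ out = out
              ... | inj₁ x∈ = let i , eq = img-preimage w x x∈ in
                ⊥-elim (true≢false (w∈W i) (trans (cong W eq) x∉))

        structure : Σ (Fin h) λ i → Σ (Graph (n ∸ toℕ i)) λ H →
          IsEX (n ∸ toℕ i) (F i) H × ((K (toℕ i) ∏ H) ≅ G)
        structure = ℓ , H , (H-free , λ G′ free → ≤-trans (proj₂ exH* G′ free) H*≤H) ,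
          σ , (σ-inj , λ y → proj₁ (σ-surj y) , λ { refl → proj₂ (σ-surj y) }) ,
          λ x y → sym (edges-tight Gσ KH sub tight x y)
          where
          J : ℕ
          J = toℕ ℓ
          J≤n : J ≤ n
          J≤n = ≤-trans (<⇒≤ (toℕ<n ℓ)) (≤-trans h≤P P≤n)
          N₁≤ : N₁ ≤ n ∸ J
          N₁≤ = ≤-trans N₁≤m (≤-trans (≤-reflexive (sym (trans (cong (_∸ P) n≡) (m+n∸m≡n P m))))
            (∸-monoʳ-≤ n (≤-trans (<⇒≤ (toℕ<n ℓ)) h≤P)))
          clique : Σ (Fin J → Fin n) λ f → Injective′ f × (∀ a → W (f a) ≡ true)
          clique = choose W (≤-reflexive ℓ≡s)
          others : Σ (Fin (n ∸ J) → Fin n) λ f → Injective′ f × (∀ a → not (W (f a)) ≡ true)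
          others = choose (not ∘ W) (≤-reflexive (trans (cong₂ _∸_ (sym (count-not W)) ℓ≡s) (m+n∸m≡n s _)))
          H : Graph (n ∸ J)
          H = pullback G (proj₁ others)
          H-free : Free (F ℓ) H
          H-free = rest-free (proj₁ others) (proj₁ (proj₂ others)) (not-true ∘ proj₂ (proj₂ others))
          KH Gσ : Graph (J + (n ∸ J))
          H* : Graph (n ∸ J)
          H* = proj₁ (ord (n ∸ J) N₁≤ ℓ)
          exH* : IsEX (n ∸ J) (F ℓ) H*
          exH* = proj₁ (proj₂ (ord (n ∸ J) N₁≤ ℓ))
          pick : Fin J ⊎ Fin (n ∸ J) → Fin n
          pick (inj₁ a) = proj₁ clique a
          pick (inj₂ b) = proj₁ others b
          apart : ∀ a b → proj₁ clique a ≢ proj₁ others b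
          apart a b eq = true≢false (proj₂ (proj₂ clique) a)
            (trans (cong W eq) (not-true (proj₂ (proj₂ others) b)))
          pick-inj : ∀ x y → pick x ≡ pick y → x ≡ y
          pick-inj (inj₁ a) (inj₁ b) eq = cong inj₁ (proj₁ (proj₂ clique) eq)
          pick-inj (inj₁ a) (inj₂ b) eq = ⊥-elim (apart a b eq)
          pick-inj (inj₂ a) (inj₁ b) eq = ⊥-elim (apart b a (sym eq))
          pick-inj (inj₂ a) (inj₂ b) eq = cong inj₂ (proj₁ (proj₂ others) eq)
          σ : Fin (J + (n ∸ J)) → Fin n
          σ x = pick (splitAt J x)
          σ-inj : Injective′ σ
          σ-inj {x} {y} eq = trans (sym (join-splitAt J _ x))
            (trans (cong (join J _) (pick-inj (splitAt J x) (splitAt J y) eq)) (join-splitAt J _ y))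
          σ-surj : ∀ y → ∃ λ x → σ x ≡ y
          σ-surj = injective⇒surjective σ σ-inj (m+[n∸m]≡n J≤n)
          KH = K J ∏ H
          Gσ = pullback G σ
          sub : ∀ x y → adj Gσ x y ≡ true → adj KH x y ≡ true
          sub x y = cases (splitAt J x) (splitAt J y)
            where
            cases : ∀ a b → adj G (pick a) (pick b) ≡ true → Defs.combine (adj (K J)) (adj H) true a b ≡ true
            cases (inj₁ a) (inj₁ b) ab with a ≟ b
            ... | no _     = refl
            ... | yes refl = ⊥-elim (true≢false ab (irrefl G _))
            cases (inj₁ a) (inj₂ b) ab = refl
            cases (inj₂ a) (inj₁ b) ab = refl
            cases (inj₂ a) (inj₂ b) ab = ab
          Gσ≡G : edges Gσ ≡ edges G
          Gσ≡G = edges-pullback G σ σ-inj σ-surj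
          H*≤G : J C 2 + J * (n ∸ J) + edges H* ≤ edges G
          H*≤G = competitor G ex ℓ J≤n N₁≤ H* exH*
          H*≤H : edges H* ≤ edges H
          H*≤H = +-cancelˡ-≤ (J C 2 + J * (n ∸ J)) _ _ (≤-trans H*≤G
            (≤-trans (≤-reflexive (sym Gσ≡G)) (≤-trans (edges-mono Gσ KH sub) (≤-reflexive (edges-join J H)))))
          -- By `sub` the graph G is contained in `KH` up to relabelling, so equal edge numbers make
          -- the two coincide; in particular every vertex of `W` is universal in G.
          tight : edges KH ≤ edges Gσ
          tight = ≤-trans (≤-reflexive (edges-join J H)) (≤-trans
            (+-monoʳ-≤ (J C 2 + J * (n ∸ J)) (proj₂ exH* H H-free)) (≤-trans H*≤G (≤-reflexive (sym Gσ≡G))))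

-- Choice of constants and conclusion

maxᶠ-member : ∀ h (f : Fin h → ℕ) i → f i ≤ maxᶠ h f
maxᶠ-member (suc h) f zero    = m≤m⊔n (f zero) _
maxᶠ-member (suc h) f (suc i) = ≤-trans (maxᶠ-member h (f ∘ suc) i) (m≤n⊔m (f zero) _)

maxᶠ-≤ : ∀ h {f : Fin h → ℕ} {b} → (∀ i → f i ≤ b) → maxᶠ h f ≤ b
maxᶠ-≤ zero    le = z≤n
maxᶠ-≤ (suc h) le = ⊔-lub (le zero) (maxᶠ-≤ h (le ∘ suc))

module _ (h p′ : ℕ) (0<h : 0 < h) (v : Fin h → ℕ) (F : (i : Fin h) → Graph (v i))
         (A : ∀ i → Apex (F i) (suc (suc p′))) (N₁ : ℕ)
         (ord : ∀ N → N₁ ≤ N → ∀ (ℓ : Fin h) →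
            Σ (Graph N) λ H → IsEX N (F ℓ) H × (∀ (j : Fin h) → toℕ j ≤ toℕ ℓ → Free (F j) H)) where

  private
    -- `P` bounds |W| + |X₀| + |X|. In units of 1/R, an additional universal vertex gains q₀n, and
    -- each of at most `P` exchanged vertices loses about 2m, the gap between R - q₀ and `g`; hence
    -- q₀ > 2P. `T` leaves room for one component beside `X`, `X₀` and the heavy vertices, and `N₃`
    -- makes the gain exceed the remaining constants.
    p r V P q₀ T N₂ N₃ : ℕ
    p  = suc p′
    r  = suc p
    V  = totalV h v
    P  = h + (V + V)
    q₀ = suc (2 * P)
    T  = V + (V + (V + h))
    N₂ = N₁ + Σᶠ h (λ i → proj₁ (extremal-growth (A i) (suc q₀)))
    N₃ = suc (P * (r * suc q₀ * P) + P * (q₀ * P))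

    ord₂ : ∀ N → N₂ ≤ N → ∀ (ℓ : Fin h) →
      Σ (Graph N) λ H → IsEX N (F ℓ) H × (∀ (j : Fin h) → toℕ j ≤ toℕ ℓ → Free (F j) H)
    ord₂ N N₂≤ = ord N (≤-trans (m≤m+n N₁ _) N₂≤)

    grow : ∀ i {m} → N₂ ≤ m → (H : Graph m) (H′ : Graph (suc m)) → IsEX m (F i) H →
      IsEX (suc m) (F i) H′ → r * suc q₀ * (edges H + m) ≤ r * suc q₀ * edges H′ + suc (suc q₀) * m
    grow i N₂≤ = proj₂ (extremal-growth (A i) (suc q₀))
      (≤-trans (Σ-member h (λ i → proj₁ (extremal-growth (A i) (suc q₀))) i) (≤-trans (m≤n+m _ N₁) N₂≤))

    ¬colourable-⋃ : ¬ Colourable (⋃ h v F) r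
    ¬colourable-⋃ col = ¬colourable (A i) (colourable-⊆ (F i) (⋃ h v F) (component-⊆ h v F i) col)
      where
      i : Fin h
      i = fromℕ< 0<h

  N₀ : ℕ
  N₀ = P + (N₂ + (N₃ + heavyThreshold p q₀ h T))

  module _ {n} (N₀≤n : N₀ ≤ n) (G : Graph n) (ex : IsEX n (⋃ h v F) G) where

    private
      m : ℕ
      m = n ∸ P

      P≤n : P ≤ n
      P≤n = ≤-trans (m≤m+n P _) N₀≤n

      m-large : N₂ + (N₃ + heavyThreshold p q₀ h T) ≤ m
      m-large = ≤-trans (≤-reflexive (sym (m+n∸m≡n P _))) (∸-monoˡ-≤ P N₀≤n)

      N₂≤m : N₂ ≤ m
      N₂≤m = ≤-trans (m≤m+n N₂ _) m-large

      i≤P : ∀ (i : Fin h) → toℕ i ≤ P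
      i≤P i = ≤-trans (<⇒≤ (toℕ<n i)) (m≤m+n h (V + V))

    extremal-structure : Σ (Fin h) λ i → Σ (Graph (n ∸ toℕ i)) λ H →
      IsEX (n ∸ toℕ i) (F i) H × ((K (toℕ i) ∏ H) ≅ G)
    extremal-structure = structure h p′ v F A N₂ ord₂ q₀ grow G ex P m T (sym (m+[n∸m]≡n P≤n))
      ≤-refl ≤-refl N₂≤m (≤-trans (m≤m+n N₃ _) (≤-trans (m≤n+m _ N₂) m-large)) ≤-refl
      (heavyBound p q₀ n) (heavyBound-light p q₀ n)
      (heavyVertices p q₀ h T G
        (≤-trans (m≤n+m _ N₃) (≤-trans (m≤n+m _ N₂) (≤-trans m-large (m∸n≤m n P))))
        (extremal⇒dense p {F = ⋃ h v F} G ¬colourable-⋃ ex))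

    extremal-number : (H : (i : Fin h) → Graph (n ∸ toℕ i)) → (∀ i → IsEX (n ∸ toℕ i) (F i) (H i)) →
      edges G ≡ maxᶠ h (λ i → toℕ i C 2 + toℕ i * (n ∸ toℕ i) + edges (H i))
    extremal-number H exH = ≤-antisym (upper extremal-structure) (maxᶠ-≤ h (λ i →
      competitor h p′ v F A N₂ ord₂ G ex i (≤-trans (i≤P i) P≤n)
        (≤-trans N₂≤m (∸-monoʳ-≤ n (i≤P i))) (H i) (exH i)))
      where
      open ≤-Reasoning
      value : Fin h → ℕ
      value i = toℕ i C 2 + toℕ i * (n ∸ toℕ i) + edges (H i)
      upper : (Σ (Fin h) λ i → Σ (Graph (n ∸ toℕ i)) λ H → IsEX (n ∸ toℕ i) (F i) H × ((K (toℕ i) ∏ H) ≅ G)) →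
        edges G ≤ maxᶠ h value
      upper (i , H′ , exH′ , iso) = begin
        edges G                                                ≡⟨ sym (≅⇒edges (K (toℕ i) ∏ H′) G iso) ⟩
        edges (K (toℕ i) ∏ H′)                                 ≡⟨ edges-join (toℕ i) H′ ⟩
        toℕ i C 2 + toℕ i * (n ∸ toℕ i) + edges H′             ≡⟨ cong (toℕ i C 2 + toℕ i * (n ∸ toℕ i) +_)
                                                                    (extremal-edges {F = F i} H′ (H i) exH′ (exH i)) ⟩
        value i                                                ≤⟨ maxᶠ-member h value i ⟩
        maxᶠ h value                                           ∎

theorem3 : (h r : ℕ) → 2 ≤ h → 2 ≤ r →
    (v : Fin h → ℕ) (F : (i : Fin h) → Graph (v i)) →
    (∀ i → VertexCritical (F i)) →
    (∀ i → ChromaticNumber (F i) (suc r)) →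
    ProperlyOrdered h v F →
    ∃ λ N₀ → ∀ n → N₀ ≤ n →
    ((G : Graph n) → IsEX n (⋃ h v F) G →
    (H : (i : Fin h) → Graph (n ∸ toℕ i)) →
    (∀ i → IsEX (n ∸ toℕ i) (F i) (H i)) →
    edges G ≡ maxᶠ h (λ i → toℕ i C 2 + toℕ i * (n ∸ toℕ i) + edges (H i)))
    ×
    ((G : Graph n) → IsEX n (⋃ h v F) G →
    Σ (Fin h) λ i → Σ (Graph (n ∸ toℕ i)) λ H →
    IsEX (n ∸ toℕ i) (F i) H × ((K (toℕ i) ∏ H) ≅ G))
theorem3 h (suc (suc p)) 2≤h (s≤s (s≤s z≤n)) v F critical chromatic (N₁ , ord) =
  N₀ h p 0<h v F A N₁ ord , λ n N₀≤n →
    extremal-number h p 0<h v F A N₁ ord N₀≤n , extremal-structure h p 0<h v F A N₁ ord N₀≤n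
  where
  0<h : 0 < h
  0<h = ≤-trans (n≤1+n 1) 2≤h
  A : ∀ i → Apex (F i) (suc (suc p))
  A i = vertexCritical⇒apex (F i) (suc p) (critical i) (chromatic i)
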